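{- Let $r \in \mathbb{N}$ and let $a_1, a_2, \ldots, a_r \in \mathbb{N}$. Then the complete $r$-partite graph $\mathcal{K}(a_1,\ldots,a_r)$ is $\mathcal{D}$-unique if and only if for all $1 \le i < j \le r$, either $\max\{a_i,a_j\} \le 2$ or $|a_i - a_j| \ge 2$.
   Context: All graphs are finite and simple, and $\mathbb{N}$ denotes the positive integers. For a graph $G=(V,E)$, $v(G)=|V|$, and $N[v]$ denotes the closed neighborhood of a vertex $v$ (i.e. $v$ together with all its neighbors). A set $S \subseteq V$ is a dominating set of $G$ if $\bigcup_{x\in S} N[x] = V$. Let $d(G,i)$ be the number of dominating sets of $G$ of cardinality $i$. The domination polynomial of $G$ is $D(G,x)=\sum_{i=1}^{v(G)} d(G,i)\, x^i$. A graph $G$ is called $\mathcal{D}$-unique if for every graph $H$, $D(H,x)=D(G,x)$ implies $H \cong G$. For $r \in \mathbb{N}$ and $a_1,\ldots,a_r\in\mathbb{N}$, $\mathcal{K}(a_1,\ldots,a_r)$ denotes the complete $r$-partite graph on $a_1+\cdots+a_r$ vertices with color classes of sizes $a_1,\ldots,a_r$ (two vertices are adjacent if and only if they lie in different color classes); for $r=1$, $\mathcal{K}(a)$ is the graph on $a$ vertices with no edges. -}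

module Defs where

open import Data.Fin using (Fin; zero; suc; splitAt)
open import Data.Fin.Properties using (all?; any?) renaming (_≟_ to _≟ᶠ_)
open import Data.Fin.Subset using (Subset; inside; outside; _∈_; ∣_∣)
open import Data.Fin.Subset.Properties using (_∈?_)
open import Data.List using (List; []; _∷_; _++_; [_]; map; filter; length; applyUpTo)
open import Data.Nat using (ℕ; zero; suc; _≟_)
open import Data.Product using (Σ; ∃; _×_)
open import Data.Sum using (_⊎_; [_,_]′)
open import Data.Vec using (Vec; []; _∷_; sum)
open import Function using (const; _∘_; _↔_; _⇔_; Inverse)
open import Level using (0ℓ)
open import Relation.Binary using (Rel; Symmetric; Irreflexive; Decidable)
open import Relation.Binary.PropositionalEquality using (_≡_; _≢_; refl; sym)
open import Relation.Nullary using (Dec; ¬?; _×-dec_; _⊎-dec_)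
open import Relation.Unary using (Pred)

-- Finite simple graphs with vertex set Fin v.  Adjacency is decidable so that
-- dominating sets can be counted.
record Graph : Set₁ where
  field
    v      : ℕ
    Adj    : Rel (Fin v) 0ℓ
    adj?   : Decidable Adj
    symm   : Symmetric Adj
    irrefl : Irreflexive _≡_ Adj

open Graph public

infix 4 _≅_ _≈ₚ_

_≅_ : Graph → Graph → Set
G ≅ H = Σ (Fin (v G) ↔ Fin (v H)) λ f →
  ∀ x y → Adj G x y ⇔ Adj H (Inverse.to f x) (Inverse.to f y)

ClosedNbhd : (G : Graph) → Fin (v G) → Pred (Fin (v G)) 0ℓ
ClosedNbhd G x y = y ≡ x ⊎ Adj G x y

-- The union of the closed neighbourhoods of the elements of S is everything.
Dominating : (G : Graph) → Subset (v G) → Set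
Dominating G S = ∀ y → ∃ λ x → x ∈ S × ClosedNbhd G x y

dominating? : (G : Graph) (S : Subset (v G)) → Dec (Dominating G S)
dominating? G S =
  all? λ y → any? λ x → (x ∈? S) ×-dec ((y ≟ᶠ x) ⊎-dec adj? G x y)

-- Every subset of Fin n is listed exactly once.
subsets : ∀ n → List (Subset n)
subsets zero    = [ [] ]
subsets (suc n) = map (outside ∷_) (subsets n) ++ map (inside ∷_) (subsets n)

d : Graph → ℕ → ℕ
d G i = length (filter (λ S → dominating? G S ×-dec (∣ S ∣ ≟ i)) (subsets (v G)))

-- Univariate polynomials as coefficient lists, constant term first.  Trailing
-- zeros are insignificant, so equality of polynomials is _≈ₚ_, not _≡_.
Poly : Set
Poly = List ℕ

coeff : Poly → ℕ → ℕ
coeff []       _       = 0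
coeff (c ∷ _)  zero    = c
coeff (_ ∷ cs) (suc k) = coeff cs k

_≈ₚ_ : Poly → Poly → Set
p ≈ₚ q = ∀ k → coeff p k ≡ coeff q k

-- Coefficients 0, d G 1, …, d G (v G): the sum starts at i = 1, so the
-- constant term is 0 (even for the graph with no vertices).
D : Graph → Poly
D G = 0 ∷ applyUpTo (λ i → d G (suc i)) (v G)

D-Unique : Graph → Set₁
D-Unique G = (H : Graph) → D H ≈ₚ D G → H ≅ G

-- The first a₁ vertices get colour 0, the next a₂ vertices colour 1, and so on.
colour : ∀ {r} (a : Vec ℕ r) → Fin (sum a) → Fin r
colour (m ∷ a) x = [ const zero , suc ∘ colour a ]′ (splitAt m x)

𝒦 : ∀ {r} → Vec ℕ r → Graph
𝒦 a = record
  { v      = sum a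
  ; Adj    = λ x y → colour a x ≢ colour a y
  ; adj?   = λ x y → ¬? (colour a x ≟ᶠ colour a y)
  ; symm   = λ x≁y e → x≁y (sym e)
  ; irrefl = λ { refl x≁x → x≁x refl }
  }

{-# OPTIONS --safe #-}
module Submission where

-- A set fails to dominate iff it avoids some x and consists of non-neighbours of x.  For
-- 𝒦(a₁,…,aᵣ) these sets are the proper subsets of the colour classes, i.e. boundaries of simplices.
--
-- Let the sizes be separated and let H have the same domination polynomial.  Going down from the
-- largest class size m, one shows that the vertices of H with at least m non-neighbours (themselves
-- included) form colour classes of the right sizes.  Their contribution to the numbers of
-- non-dominating sets can then be discarded.  If m ≥ 3 is a class size, it occurs once and m − 1
-- does not occur, so what is left has m sets of size m − 1 and C(m,2) sets of size m − 2: this is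
-- the equality case of the Kruskal–Katona theorem, and the m sets are the facets of one simplex.
-- Each of its m vertices lies in m − 1 of the facets and hence has all its non-neighbours among the
-- vertices of the simplex, which is therefore a colour class.
--
-- Conversely, two classes of sizes p ≤ q ≤ p + 1 with q ≥ 3 can be rewired, making non-adjacency
-- bipartite between them, without changing the numbers of non-dominating sets.

open import Defs
open import Algebra.Properties.CommutativeSemigroup using (interchange)
open import Data.Bool using (true; false) renaming (_≟_ to _≟ᵇ_)
open import Data.Empty using (⊥)
open import Data.Fin
  using (Fin; zero; suc; _<_; punchOut; toℕ; fromℕ<; splitAt; _↑ˡ_; _↑ʳ_) renaming (_≟_ to _≟ᶠ_)
open import Data.Fin.Properties
  using (any?; punchOut-injective; injective⇒≤; ¬∀⟶∃¬; splitAt-↑ˡ; splitAt-↑ʳ;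
         splitAt⁻¹-↑ˡ; splitAt⁻¹-↑ʳ; toℕ<n; toℕ-fromℕ<; toℕ-injective)
  renaming (<-cmp to <ᶠ-cmp; <⇒≢ to <ᶠ⇒≢; suc-injective to sucᶠ-injective)
open import Data.Fin.Subset
  using (Subset; inside; outside; _∈_; _∉_; _⊆_; ∣_∣; ⊤; ⁅_⁆; _∩_; _∪_; _─_; Nonempty)
open import Data.Fin.Subset.Properties
  using (_∈?_; _⊆?_; ∣p∣≤n; p⊆q⇒∣p∣≤∣q∣; p⊂q⇒∣p∣<∣q∣; p∩q≢∅⇒∣p─q∣<∣p∣; ⊆-antisym; drop-there;
         drop-∷-⊆; out⊆; in⊆in; x∈p∩q⁺; x∈p∩q⁻; x∈p∪q⁻; nonempty?; ∣⁅x⁆∣≡1; x∈⁅y⁆⇒x≡y; x∈⁅x⁆;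
         ∈⊤; ∣⊤∣≡n; x∈p∧x∉q⇒x∈p─q; p─q⊆p; p∩q⊆p; p∩q⊆q; ∩-distribˡ-∪; p⊆p∪q; q⊆p∪q)
open import Data.List using (List; []; _∷_; _++_; map; filter; length; allFin; applyUpTo)
open import Data.List.Membership.Propositional using () renaming (_∈_ to _∈ˡ_)
open import Data.List.Membership.Propositional.Properties
  using (∈-allFin; ∈-++⁺ˡ; ∈-++⁺ʳ; ∈-map⁺)
open import Data.List.Properties using (map-++; map-∘; map-tabulate)
open import Data.List.Relation.Unary.Any using (here; there)
open import Data.Nat
  using (ℕ; zero; suc; _+_; _*_; _≤_; _⊔_; ∣_-_∣; z≤n; s≤s; _≟_; _≤?_; _<?_; >-nonZero)
  renaming (_<_ to _<ⁿ_)
open import Data.Nat.Combinatorics using (_C_; nCk+nC[k+1]≡[n+1]C[k+1]; nCn≡1; k>n⇒nCk≡0)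
open import Data.Nat.ListAction using (sum)
open import Data.Nat.ListAction.Properties using (sum-++)
open import Data.Nat.Properties
open import Data.Nat.Tactic.RingSolver using (solve-∀)
open import Data.Product using (Σ; ∃; _×_; _,_; proj₁; proj₂)
open import Data.Sum as Sum using (_⊎_; inj₁; inj₂; [_,_]′)
open import Data.Vec as Vec using (Vec; lookup; []; _∷_; here; there)
open import Data.Vec.Properties using (≡-dec; lookup∘tabulate; lookup⇒[]=; []=⇒lookup)
open import Function using (_⇔_; _↔_; _∘_; id)
open import Function.Bundles using (mk⇔; mk↔ₛ′; Equivalence; Inverse)
open import Level using (0ℓ)
open import Relation.Binary.Definitions using (tri<; tri≈; tri>)
open import Relation.Binary.PropositionalEquality
open import Relation.Nullary
  using (Dec; does; yes; no; ¬_; ¬?; _×-dec_; _⊎-dec_; _because_; contradiction)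
open import Relation.Nullary.Decidable using (dec-true; dec-false; decidable-stable)
open import Relation.Unary using (Pred; Decidable)

private variable
  A B   : Set
  P Q R : Set
  n m   : ℕ

-- Counting with finite sums

⟦_⟧ : Dec P → ℕ
⟦ true  because _ ⟧ = 1
⟦ false because _ ⟧ = 0

⟦⟧≡1 : (p? : Dec P) → P → ⟦ p? ⟧ ≡ 1
⟦⟧≡1 (yes _) _ = refl
⟦⟧≡1 (no ¬p) p = contradiction p ¬p

⟦⟧≡0 : (p? : Dec P) → ¬ P → ⟦ p? ⟧ ≡ 0
⟦⟧≡0 (yes p) ¬p = contradiction p ¬p
⟦⟧≡0 (no _) _ = refl

⟦⟧-mono : (p? : Dec P) (q? : Dec Q) → (P → Q) → ⟦ p? ⟧ ≤ ⟦ q? ⟧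
⟦⟧-mono (no _) _ _ = z≤n
⟦⟧-mono (yes p) q? f = ≤-reflexive (sym (⟦⟧≡1 q? (f p)))

⟦⟧-cong : (p? : Dec P) (q? : Dec Q) → (P → Q) → (Q → P) → ⟦ p? ⟧ ≡ ⟦ q? ⟧
⟦⟧-cong p? q? f g = ≤-antisym (⟦⟧-mono p? q? f) (⟦⟧-mono q? p? g)

⟦⟧-× : (p? : Dec P) (q? : Dec Q) → ⟦ p? ×-dec q? ⟧ ≡ ⟦ p? ⟧ * ⟦ q? ⟧
⟦⟧-× (yes _) (yes _) = refl
⟦⟧-× (yes _) (no _) = refl
⟦⟧-× (no _) _ = refl

⟦⟧-⊎ : (p? : Dec P) (q? : Dec Q) (r? : Dec R) →
  (R → P ⊎ Q) → (P → R) → (Q → R) → ¬ (P × Q) → ⟦ r? ⟧ ≡ ⟦ p? ⟧ + ⟦ q? ⟧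
⟦⟧-⊎ (yes p) (yes q) _ _ _ _ disj = contradiction (p , q) disj
⟦⟧-⊎ (yes p) (no _) r? _ f _ _ = ⟦⟧≡1 r? (f p)
⟦⟧-⊎ (no _) (yes q) r? _ _ g _ = ⟦⟧≡1 r? (g q)
⟦⟧-⊎ (no ¬p) (no ¬q) r? e _ _ _ = ⟦⟧≡0 r? λ r → [ ¬p , ¬q ]′ (e r)

⟦⟧-split : (p? : Dec P) (q? : Dec Q) → ⟦ p? ⟧ ≡ ⟦ p? ×-dec q? ⟧ + ⟦ p? ×-dec ¬? q? ⟧
⟦⟧-split (yes _) (yes _) = refl
⟦⟧-split (yes _) (no _) = refl
⟦⟧-split (no _) _ = refl

∑ : List A → (A → ℕ) → ℕ
∑ xs f = sum (map f xs)

∑-cong : ∀ (xs : List A) {f g : A → ℕ} → (∀ x → f x ≡ g x) → ∑ xs f ≡ ∑ xs g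
∑-cong [] _ = refl
∑-cong (x ∷ xs) e = cong₂ _+_ (e x) (∑-cong xs e)

∑-mono : ∀ (xs : List A) {f g : A → ℕ} → (∀ x → f x ≤ g x) → ∑ xs f ≤ ∑ xs g
∑-mono [] _ = z≤n
∑-mono (x ∷ xs) e = +-mono-≤ (e x) (∑-mono xs e)

∑-+ : ∀ (xs : List A) (f g : A → ℕ) → ∑ xs (λ x → f x + g x) ≡ ∑ xs f + ∑ xs g
∑-+ [] _ _ = refl
∑-+ (x ∷ xs) f g =
  trans (cong (f x + g x +_) (∑-+ xs f g))
    (interchange +-commutativeSemigroup (f x) (g x) (∑ xs f) (∑ xs g))

∑-*ˡ : ∀ (xs : List A) c (f : A → ℕ) → ∑ xs (λ x → c * f x) ≡ c * ∑ xs f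
∑-*ˡ [] c _ = sym (*-zeroʳ c)
∑-*ˡ (x ∷ xs) c f =
  trans (cong (c * f x +_) (∑-*ˡ xs c f)) (sym (*-distribˡ-+ c (f x) (∑ xs f)))

∑-*ʳ : ∀ (xs : List A) c (f : A → ℕ) → ∑ xs (λ x → f x * c) ≡ ∑ xs f * c
∑-*ʳ xs c f = trans (∑-cong xs λ x → *-comm (f x) c) (trans (∑-*ˡ xs c f) (*-comm c _))

∑-zero : ∀ (xs : List A) {f : A → ℕ} → (∀ x → f x ≡ 0) → ∑ xs f ≡ 0
∑-zero [] _ = refl
∑-zero (x ∷ xs) e = cong₂ _+_ (e x) (∑-zero xs e)

∑-swap : ∀ (xs : List A) (ys : List B) (f : A → B → ℕ) →
  ∑ xs (λ x → ∑ ys (f x)) ≡ ∑ ys (λ y → ∑ xs (λ x → f x y))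
∑-swap [] ys f = sym (∑-zero ys λ _ → refl)
∑-swap (x ∷ xs) ys f =
  trans (cong (∑ ys (f x) +_) (∑-swap xs ys f)) (sym (∑-+ ys (f x) _))

∑-member : ∀ {xs : List A} (f : A → ℕ) {x} → x ∈ˡ xs → f x ≤ ∑ xs f
∑-member f (here refl) = m≤m+n _ _
∑-member f (there x∈) = ≤-trans (∑-member f x∈) (m≤n+m _ _)

-- One strict inequality would make the total of `f` strictly smaller. This extracts from each tight
-- double count below an equality at a single ridge, facet or vertex.
∑-rigid : ∀ (xs : List A) {f g : A → ℕ} → (∀ x → f x ≤ g x) → ∑ xs g ≤ ∑ xs f →
  ∀ {x} → x ∈ˡ xs → f x ≡ g x
∑-rigid (y ∷ xs) {f} {g} f≤g le (here refl) = ≤-antisym (f≤g y)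
  (+-cancelʳ-≤ (∑ xs g) (g y) (f y) (≤-trans le (+-monoʳ-≤ (f y) (∑-mono xs f≤g))))
∑-rigid (y ∷ xs) {f} {g} f≤g le (there x∈) = ∑-rigid xs f≤g
  (+-cancelˡ-≤ (g y) _ _ (≤-trans le (+-monoˡ-≤ (∑ xs f) (f≤g y)))) x∈

∑-witness : ∀ (xs : List A) {P : A → Set} (P? : ∀ x → Dec (P x)) →
  1 ≤ ∑ xs (λ x → ⟦ P? x ⟧) → ∃ P
∑-witness (x ∷ xs) P? le with P? x
... | yes p = x , p
... | no _ = ∑-witness xs P? le

∑-++ : ∀ (xs ys : List A) (f : A → ℕ) → ∑ (xs ++ ys) f ≡ ∑ xs f + ∑ ys f
∑-++ xs ys f = trans (cong sum (map-++ f xs ys)) (sum-++ (map f xs) (map f ys))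

∑-map : ∀ (g : A → B) xs (f : B → ℕ) → ∑ (map g xs) f ≡ ∑ xs (f ∘ g)
∑-map g xs f = cong sum (sym (map-∘ xs))

∑-filter : ∀ {P : A → Set} (P? : ∀ x → Dec (P x)) xs →
  length (filter P? xs) ≡ ∑ xs (λ x → ⟦ P? x ⟧)
∑-filter P? [] = refl
∑-filter P? (x ∷ xs) with P? x
... | yes _ = cong suc (∑-filter P? xs)
... | no _ = ∑-filter P? xs

∑-suc : ∀ n (f : Fin (suc n) → ℕ) → ∑ (allFin (suc n)) f ≡ f zero + ∑ (allFin n) (f ∘ suc)
∑-suc n f = cong (λ xs → f zero + sum xs)
  (trans (map-tabulate suc f) (sym (map-tabulate id (f ∘ suc))))

∑-subsets : ∀ n (f : Subset (suc n) → ℕ) → ∑ (subsets (suc n)) f ≡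
  ∑ (subsets n) (f ∘ (outside ∷_)) + ∑ (subsets n) (f ∘ (inside ∷_))
∑-subsets n f = trans (∑-++ (map (outside ∷_) (subsets n)) _ f)
  (cong₂ _+_ (∑-map _ (subsets n) f) (∑-map _ (subsets n) f))

∈-subsets : (S : Subset n) → S ∈ˡ subsets n
∈-subsets [] = here refl
∈-subsets (outside ∷ S) = ∈-++⁺ˡ (∈-map⁺ _ (∈-subsets S))
∈-subsets {suc n} (inside ∷ S) =
  ∈-++⁺ʳ (map (outside ∷_) (subsets n)) (∈-map⁺ _ (∈-subsets S))

∑-card : (S : Subset n) → ∑ (allFin n) (λ x → ⟦ x ∈? S ⟧) ≡ ∣ S ∣
∑-card [] = refl
∑-card {suc n} (s ∷ S) = trans (∑-suc n _) (head s)
  where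
  tail : ∀ s → ∑ (allFin n) (λ x → ⟦ suc x ∈? (s ∷ S) ⟧) ≡ ∣ S ∣
  tail s = trans (∑-cong (allFin n) λ x → ⟦⟧-cong (suc x ∈? (s ∷ S)) (x ∈? S) drop-there there)
    (∑-card S)
  head : ∀ s → ⟦ zero ∈? (s ∷ S) ⟧ + ∑ (allFin n) (λ x → ⟦ suc x ∈? (s ∷ S) ⟧) ≡ ∣ s ∷ S ∣
  head inside = cong suc (tail inside)
  head outside = tail outside

infix 4 _≟ˢ_
_≟ˢ_ : (S T : Subset n) → Dec (S ≡ T)
_≟ˢ_ = ≡-dec _≟ᵇ_

∑-δ : (T : Subset n) → ∑ (subsets n) (λ S → ⟦ S ≟ˢ T ⟧) ≡ 1
∑-δ [] = refl
∑-δ {suc n} (t ∷ T) = trans (∑-subsets n _) (go t)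
  where
  same : ∀ t → ∑ (subsets n) (λ S → ⟦ t ∷ S ≟ˢ t ∷ T ⟧) ≡ 1
  same t = trans (∑-cong (subsets n) λ S → ⟦⟧-cong (t ∷ S ≟ˢ t ∷ T) (S ≟ˢ T)
    (λ { refl → refl }) (λ { refl → refl })) (∑-δ T)
  other : ∀ s t → s ≢ t → ∑ (subsets n) (λ S → ⟦ s ∷ S ≟ˢ t ∷ T ⟧) ≡ 0
  other s t s≢t = ∑-zero (subsets n) λ S → ⟦⟧≡0 (s ∷ S ≟ˢ t ∷ T) λ { refl → s≢t refl }
  go : ∀ t → ∑ (subsets n) (λ S → ⟦ outside ∷ S ≟ˢ t ∷ T ⟧) +
             ∑ (subsets n) (λ S → ⟦ inside ∷ S ≟ˢ t ∷ T ⟧) ≡ 1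
  go inside = cong₂ _+_ (other outside inside λ ()) (same inside)
  go outside = cong₂ _+_ (same outside) (other inside outside λ ())

-- By induction on the ground set. When the first element belongs to `U`, the cases that `S` omits
-- or contains it give the two terms of Pascal's rule.
∑-subsets-C : (U : Subset n) (i : ℕ) →
  ∑ (subsets n) (λ S → ⟦ (∣ S ∣ ≟ i) ×-dec (S ⊆? U) ⟧) ≡ ∣ U ∣ C i
∑-subsets-C [] zero = refl
∑-subsets-C [] (suc i) = refl
∑-subsets-C {suc n} (outside ∷ U) i = trans (∑-subsets n _) (trans (cong₂ _+_
  (trans (∑-cong (subsets n) λ S → ⟦⟧-cong
    ((∣ S ∣ ≟ i) ×-dec (outside ∷ S ⊆? outside ∷ U)) ((∣ S ∣ ≟ i) ×-dec (S ⊆? U))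
    (λ { (e , s) → e , drop-∷-⊆ s }) (λ { (e , s) → e , out⊆ s })) (∑-subsets-C U i))
  (∑-zero (subsets n) λ S → ⟦⟧≡0 ((suc ∣ S ∣ ≟ i) ×-dec (inside ∷ S ⊆? outside ∷ U))
    λ { (_ , s) → contradiction (s here) λ () }))
  (+-identityʳ _))
∑-subsets-C {suc n} (inside ∷ U) i = trans (∑-subsets n _) (trans (cong₂ _+_
  (trans (∑-cong (subsets n) λ S → ⟦⟧-cong
    ((∣ S ∣ ≟ i) ×-dec (outside ∷ S ⊆? inside ∷ U)) ((∣ S ∣ ≟ i) ×-dec (S ⊆? U))
    (λ { (e , s) → e , drop-∷-⊆ {s = outside} {t = outside} (λ { (there x∈) → there (drop-there (s (there x∈))) }) })
    (λ { (e , s) → e , out⊆ s })) (∑-subsets-C U i)) refl) (go i))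
  where
  in-summand : ℕ → ℕ
  in-summand i = ∑ (subsets n) (λ S → ⟦ (suc ∣ S ∣ ≟ i) ×-dec (inside ∷ S ⊆? inside ∷ U) ⟧)
  go : ∀ i → ∣ U ∣ C i + in-summand i ≡ suc ∣ U ∣ C i
  go zero = cong₂ _+_ {v = 0} refl (∑-zero (subsets n) λ S →
    ⟦⟧≡0 ((suc ∣ S ∣ ≟ 0) ×-dec (inside ∷ S ⊆? inside ∷ U)) λ ())
  go (suc i) = trans (cong (∣ U ∣ C suc i +_) (trans (∑-cong (subsets n) λ S → ⟦⟧-cong
    ((suc ∣ S ∣ ≟ suc i) ×-dec (inside ∷ S ⊆? inside ∷ U)) ((∣ S ∣ ≟ i) ×-dec (S ⊆? U))
    (λ { (e , s) → suc-injective e , drop-∷-⊆ s }) (λ { (e , s) → cong suc e , in⊆in s }))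
    (∑-subsets-C U i)))
    (trans (+-comm (∣ U ∣ C suc i) _) (nCk+nC[k+1]≡[n+1]C[k+1] ∣ U ∣ i))

-- Cardinalities of finite subsets

∣p∪q∣+∣p∩q∣≡∣p∣+∣q∣ : (p q : Subset n) → ∣ p ∪ q ∣ + ∣ p ∩ q ∣ ≡ ∣ p ∣ + ∣ q ∣
∣p∪q∣+∣p∩q∣≡∣p∣+∣q∣ [] [] = refl
∣p∪q∣+∣p∩q∣≡∣p∣+∣q∣ (outside ∷ p) (outside ∷ q) = ∣p∪q∣+∣p∩q∣≡∣p∣+∣q∣ p q
∣p∪q∣+∣p∩q∣≡∣p∣+∣q∣ (inside ∷ p) (outside ∷ q) = cong suc (∣p∪q∣+∣p∩q∣≡∣p∣+∣q∣ p q)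
∣p∪q∣+∣p∩q∣≡∣p∣+∣q∣ (outside ∷ p) (inside ∷ q) =
  trans (cong suc (∣p∪q∣+∣p∩q∣≡∣p∣+∣q∣ p q)) (sym (+-suc ∣ p ∣ ∣ q ∣))
∣p∪q∣+∣p∩q∣≡∣p∣+∣q∣ (inside ∷ p) (inside ∷ q) = cong suc (trans (+-suc ∣ p ∪ q ∣ ∣ p ∩ q ∣)
  (trans (cong suc (∣p∪q∣+∣p∩q∣≡∣p∣+∣q∣ p q)) (sym (+-suc ∣ p ∣ ∣ q ∣))))

p⊆q∧∣q∣≤∣p∣⇒p≡q : {p q : Subset n} → p ⊆ q → ∣ q ∣ ≤ ∣ p ∣ → p ≡ q
p⊆q∧∣q∣≤∣p∣⇒p≡q {p = p} {q} p⊆q le = ⊆-antisym p⊆q back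
  where
  back : q ⊆ p
  back {x} x∈q with x ∈? p
  ... | yes x∈p = x∈p
  ... | no x∉p = contradiction le (<⇒≱ (p⊂q⇒∣p∣<∣q∣ (p⊆q , x , x∈q , x∉p)))

∣p∣<∣q∣⇒∃∈q∖p : (p q : Subset n) → ∣ p ∣ <ⁿ ∣ q ∣ → ∃ λ x → x ∈ q × x ∉ p
∣p∣<∣q∣⇒∃∈q∖p p q lt with any? (λ x → (x ∈? q) ×-dec ¬? (x ∈? p))
... | yes found = found
... | no none = contradiction (p⊆q⇒∣p∣≤∣q∣ q⊆p) (<⇒≱ lt)
  where
  q⊆p : q ⊆ p
  q⊆p {x} x∈q with x ∈? p
  ... | yes x∈p = x∈p
  ... | no x∉p = contradiction (x , x∈q , x∉p) none

x∈p─q⇒x∉q : (p q : Subset n) {x : Fin n} → x ∈ p ─ q → x ∉ q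
x∈p─q⇒x∉q (_ ∷ p) (outside ∷ q) (there x∈) (there x∈q) = x∈p─q⇒x∉q p q x∈ x∈q
x∈p─q⇒x∉q (_ ∷ p) (inside ∷ q) (there x∈) (there x∈q) = x∈p─q⇒x∉q p q x∈ x∈q

∣p─q∣+∣p∩q∣≡∣p∣ : (p q : Subset n) → ∣ p ─ q ∣ + ∣ p ∩ q ∣ ≡ ∣ p ∣
∣p─q∣+∣p∩q∣≡∣p∣ [] [] = refl
∣p─q∣+∣p∩q∣≡∣p∣ (outside ∷ p) (outside ∷ q) = ∣p─q∣+∣p∩q∣≡∣p∣ p q
∣p─q∣+∣p∩q∣≡∣p∣ (outside ∷ p) (inside ∷ q) = ∣p─q∣+∣p∩q∣≡∣p∣ p q
∣p─q∣+∣p∩q∣≡∣p∣ (inside ∷ p) (outside ∷ q) = cong suc (∣p─q∣+∣p∩q∣≡∣p∣ p q)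
∣p─q∣+∣p∩q∣≡∣p∣ (inside ∷ p) (inside ∷ q) =
  trans (+-suc ∣ p ─ q ∣ _) (cong suc (∣p─q∣+∣p∩q∣≡∣p∣ p q))

x∈p⇒1+∣p─x∣≡∣p∣ : {p : Subset n} {x : Fin n} → x ∈ p → suc ∣ p ─ ⁅ x ⁆ ∣ ≡ ∣ p ∣
x∈p⇒1+∣p─x∣≡∣p∣ {p = p} {x} x∈p = trans (+-comm 1 ∣ p ─ ⁅ x ⁆ ∣)
  (trans (cong (∣ p ─ ⁅ x ⁆ ∣ +_) (sym (trans (cong ∣_∣ p∩x≡x) (∣⁅x⁆∣≡1 x)))) (∣p─q∣+∣p∩q∣≡∣p∣ p ⁅ x ⁆))
  where
  p∩x≡x : p ∩ ⁅ x ⁆ ≡ ⁅ x ⁆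
  p∩x≡x = ⊆-antisym (p∩q⊆q p ⁅ x ⁆)
    λ y∈ → x∈p∩q⁺ (subst (_∈ p) (sym (x∈⁅y⁆⇒x≡y x y∈)) x∈p , y∈)

∣p∣>0⇒Nonempty : {p : Subset n} → 1 ≤ ∣ p ∣ → Nonempty p
∣p∣>0⇒Nonempty {n} {p} le =
  ∑-witness (allFin n) (_∈? p) (≤-trans le (≤-reflexive (sym (∑-card p))))

-- A reflexive symmetric relation given by its neighbourhoods.  For a graph the relation is
-- non-adjacency: S fails to dominate iff S ⊆ K x ∖ {x} for some x, and complete multipartite
-- graphs are those for which the relation is an equivalence.
record Tolerance (n : ℕ) : Set where
  field
    K      : Fin n → Subset n
    K-refl : ∀ x → x ∈ K x
    K-sym  : ∀ {x y} → y ∈ K x → x ∈ K y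

  size : Fin n → ℕ
  size x = ∣ K x ∣

  -- Makes `K x` an equivalence class. The condition is imposed vertex by vertex because the descent
  -- on sizes establishes it for large neighbourhoods first.
  Clean : Fin n → Set
  Clean x = ∀ {y} → y ∈ K x → K y ≡ K x

  -- With `Q` always true these are the non-dominating sets, `x` being a vertex left undominated.
  -- The condition on `size x` allows the contributions of large and small neighbourhoods to be
  -- counted apart.
  Face : Pred ℕ 0ℓ → Subset n → Set
  Face Q S = ∃ λ x → Q (size x) × x ∉ S × S ⊆ K x

  face? : ∀ {Q} → Decidable Q → ∀ S → Dec (Face Q S)
  face? Q? S = any? λ x → Q? (size x) ×-dec ¬? (x ∈? S) ×-dec (S ⊆? K x)

  faces : ∀ {Q} → Decidable Q → ℕ → ℕ
  faces Q? i = ∑ (subsets n) λ S → ⟦ (∣ S ∣ ≟ i) ×-dec face? Q? S ⟧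

  count : ∀ {Q} → Decidable Q → ℕ
  count Q? = ∑ (allFin n) λ x → ⟦ Q? (size x) ⟧

  size>0 : ∀ x → 1 ≤ size x
  size>0 x = ≤-trans (≤-reflexive (sym (∣⁅x⁆∣≡1 x)))
    (p⊆q⇒∣p∣≤∣q∣ λ y∈ → subst (_∈ K x) (sym (x∈⁅y⁆⇒x≡y x y∈)) (K-refl x))

  Face⇒∣S∣<size : ∀ {S x} → x ∉ S → S ⊆ K x → ∣ S ∣ <ⁿ size x
  Face⇒∣S∣<size {x = x} x∉S S⊆ = p⊂q⇒∣p∣<∣q∣ (S⊆ , x , K-refl x , x∉S)

  -- By symmetry `y` lies in `K z`, and `K z` is `K x`.
  Clean-shared : ∀ {x y z} → Clean x → z ∈ K x → z ∈ K y → K y ≡ K x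
  Clean-shared {y = y} clean z∈Kx z∈Ky = clean (subst (y ∈_) (clean z∈Kx) (K-sym z∈Ky))

  module _ {Q₁ Q₂ Q : Pred ℕ 0ℓ} (Q₁? : Decidable Q₁) (Q₂? : Decidable Q₂) (Q? : Decidable Q)
    (split : ∀ s → Q s → Q₁ s ⊎ Q₂ s) (Q₁⇒Q : ∀ s → Q₁ s → Q s) (Q₂⇒Q : ∀ s → Q₂ s → Q s)
    (disjoint : ∀ s → ¬ (Q₁ s × Q₂ s)) where

    count-⊎ : count Q? ≡ count Q₁? + count Q₂?
    count-⊎ = trans (∑-cong (allFin n) λ x → let s = size x in ⟦⟧-⊎ (Q₁? s) (Q₂? s) (Q? s)
      (split s) (Q₁⇒Q s) (Q₂⇒Q s) (disjoint s)) (∑-+ (allFin n) _ _)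

    -- If a nonempty set lies both in a clean `K x` and in `K y`, the two coincide, so no such set
    -- has witnesses of both kinds. The empty set is a face at every vertex, hence `1 ≤ i`.
    faces-⊎ : (∀ x → Q₁ (size x) → Clean x) →
      ∀ i → 1 ≤ i → faces Q? i ≡ faces Q₁? i + faces Q₂? i
    faces-⊎ clean i 1≤i = trans (∑-cong (subsets n) λ S → ⟦⟧-⊎
      ((∣ S ∣ ≟ i) ×-dec face? Q₁? S) ((∣ S ∣ ≟ i) ×-dec face? Q₂? S) ((∣ S ∣ ≟ i) ×-dec face? Q? S)
      (λ { (e , x , q , r) → Sum.map (λ q₁ → e , x , q₁ , r) (λ q₂ → e , x , q₂ , r)
                               (split (size x) q) })
      (λ { (e , x , q , r) → e , x , Q₁⇒Q _ q , r })
      (λ { (e , x , q , r) → e , x , Q₂⇒Q _ q , r })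
      (λ { ((refl , x , q₁ , _ , S⊆x) , (_ , y , q₂ , _ , S⊆y)) →
        let z , z∈S = ∣p∣>0⇒Nonempty 1≤i
        in disjoint (size x)
             (q₁ , subst Q₂ (cong ∣_∣ (Clean-shared (clean x q₁) (S⊆x z∈S) (S⊆y z∈S))) q₂) }))
      (∑-+ (subsets n) _ _)

  faces≡0 : ∀ {Q} (Q? : Decidable Q) i → (∀ x → Q (size x) → size x ≤ i) → faces Q? i ≡ 0
  faces≡0 Q? i small = ∑-zero (subsets n) λ S → ⟦⟧≡0 ((∣ S ∣ ≟ i) ×-dec face? Q? S)
    λ { (refl , x , q , x∉S , S⊆) → <⇒≱ (Face⇒∣S∣<size x∉S S⊆) (small x q) }

  -- Both sides count the pairs (S , x) with ∣ S ∣ ≡ i, size x ≡ m and S ⊆ K x.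
  faces-clean : ∀ m i → (∀ x → size x ≡ m → Clean x) → 1 ≤ i → i <ⁿ m →
    faces (_≟ m) i * m ≡ count (_≟ m) * (m C i)
  faces-clean m i clean 1≤i i<m = begin
    faces (_≟ m) i * m
      ≡⟨ ∑-*ʳ (subsets n) m _ ⟨
    ∑ (subsets n) (λ S → ⟦ (∣ S ∣ ≟ i) ×-dec face? (_≟ m) S ⟧ * m)
      ≡⟨ ∑-cong (subsets n) by-subset ⟩
    ∑ (subsets n) (λ S → ∑ (allFin n) (λ x → ⟦ pair? S x ⟧))
      ≡⟨ ∑-swap (subsets n) (allFin n) _ ⟩
    ∑ (allFin n) (λ x → ∑ (subsets n) (λ S → ⟦ pair? S x ⟧))
      ≡⟨ ∑-cong (allFin n) by-vertex ⟩
    ∑ (allFin n) (λ x → ⟦ size x ≟ m ⟧ * (m C i))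
      ≡⟨ ∑-*ʳ (allFin n) (m C i) _ ⟩
    count (_≟ m) * (m C i) ∎
    where
    open ≡-Reasoning
    pair? : ∀ S x → Dec (size x ≡ m × ∣ S ∣ ≡ i × S ⊆ K x)
    pair? S x = (size x ≟ m) ×-dec (∣ S ∣ ≟ i) ×-dec (S ⊆? K x)

    by-vertex : ∀ x → ∑ (subsets n) (λ S → ⟦ pair? S x ⟧) ≡ ⟦ size x ≟ m ⟧ * (m C i)
    by-vertex x = trans (∑-cong (subsets n) λ S → ⟦⟧-× (size x ≟ m) _)
      (trans (∑-*ˡ (subsets n) ⟦ size x ≟ m ⟧ _)
      (trans (cong (⟦ size x ≟ m ⟧ *_) (∑-subsets-C (K x) i)) fix))
      where
      fix : ⟦ size x ≟ m ⟧ * (size x C i) ≡ ⟦ size x ≟ m ⟧ * (m C i)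
      fix with size x ≟ m
      ... | yes e = cong (λ s → 1 * (s C i)) e
      ... | no _ = refl

    by-subset : ∀ S → ⟦ (∣ S ∣ ≟ i) ×-dec face? (_≟ m) S ⟧ * m ≡ ∑ (allFin n) (λ x → ⟦ pair? S x ⟧)
    by-subset S with (∣ S ∣ ≟ i) ×-dec face? (_≟ m) S
    -- Since `S` is nonempty, the vertices `x` to be counted are exactly the members of the class
    -- `K y`.
    ... | yes (refl , y , refl , y∉S , S⊆) =
      let z , z∈S = ∣p∣>0⇒Nonempty 1≤i in
      trans (*-identityˡ _) (sym (trans (∑-cong (allFin n) λ x → ⟦⟧-cong (pair? S x) (x ∈? K y)
        (λ { (_ , _ , S⊆x) → subst (x ∈_)
               (Clean-shared (clean y refl) (S⊆ z∈S) (S⊆x z∈S)) (K-refl x) })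
        (λ x∈ → cong ∣_∣ (clean y refl x∈) , refl ,
                λ {w} w∈ → subst (w ∈_) (sym (clean y refl x∈)) (S⊆ w∈)))
        (∑-card (K y))))
    ... | no ¬face = sym (∑-zero (allFin n) λ x → ⟦⟧≡0 (pair? S x)
      λ { (refl , refl , S⊆x) →
        -- As i < m, some member of the class lies outside `S`, and it would make `S` a face.
        let z , z∈x , z∉S = ∣p∣<∣q∣⇒∃∈q∖p S (K x) i<m
            Kz≡Kx = clean x refl z∈x
        in ¬face (refl , z , cong ∣_∣ Kz≡Kx , z∉S , λ {w} w∈ → subst (w ∈_) (sym Kz≡Kx) (S⊆x w∈)) })

-- The equality case of the Kruskal–Katona theorem

-- The difference of the two sides is (t - 1)(t - 2), a product of consecutive integers, which is
-- never negative.
3t≤t²+2 : ∀ t → 3 * t ≤ t * t + 2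
3t≤t²+2 0 = z≤n
3t≤t²+2 1 = ≤-refl
3t≤t²+2 (suc (suc t)) =
  ≤-trans (m≤m+n (3 * (2 + t)) (t * t + t)) (≤-reflexive (eq t))
  where
  eq : ∀ t → 3 * (2 + t) + (t * t + t) ≡ (2 + t) * (2 + t) + 2
  eq = solve-∀

3t≡t²+2⇒t≤2 : ∀ t → 3 * t ≡ t * t + 2 → t ≤ 2
3t≡t²+2⇒t≤2 0 _ = z≤n
3t≡t²+2⇒t≤2 1 _ = s≤s z≤n
3t≡t²+2⇒t≤2 2 _ = ≤-refl
3t≡t²+2⇒t≤2 (suc (suc (suc t))) e =
  contradiction (trans e (eq t)) (m≢1+m+n (3 * (3 + t)))
  where
  eq : ∀ t → (3 + t) * (3 + t) + 2 ≡ suc (3 * (3 + t) + (t * t + 3 * t + 1))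
  eq = solve-∀

[2+k]C[1+k]≡2+k : ∀ k → (2 + k) C (1 + k) ≡ 2 + k
[2+k]C[1+k]≡2+k zero = refl
[2+k]C[1+k]≡2+k (suc k) = trans (sym (nCk+nC[k+1]≡[n+1]C[k+1] (2 + k) (1 + k)))
  (trans (cong₂ _+_ ([2+k]C[1+k]≡2+k k) (nCn≡1 (2 + k))) (+-comm (2 + k) 1))

[3+k]C[1+k]*2≡[3+k]*[2+k] : ∀ k → ((3 + k) C (1 + k)) * 2 ≡ (3 + k) * (2 + k)
[3+k]C[1+k]*2≡[3+k]*[2+k] zero = refl
[3+k]C[1+k]*2≡[3+k]*[2+k] (suc k) = begin
  ((4 + k) C (2 + k)) * 2
    ≡⟨ cong (_* 2) (nCk+nC[k+1]≡[n+1]C[k+1] (3 + k) (1 + k)) ⟨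
  (((3 + k) C (1 + k)) + ((3 + k) C (2 + k))) * 2
    ≡⟨ *-distribʳ-+ 2 ((3 + k) C (1 + k)) _ ⟩
  ((3 + k) C (1 + k)) * 2 + ((3 + k) C (2 + k)) * 2
    ≡⟨ cong₂ (λ x y → x + y * 2) ([3+k]C[1+k]*2≡[3+k]*[2+k] k) ([2+k]C[1+k]≡2+k (suc k)) ⟩
  (3 + k) * (2 + k) + (3 + k) * 2
    ≡⟨ eq k ⟩
  (4 + k) * (3 + k) ∎
  where
  open ≡-Reasoning
  eq : ∀ k → (3 + k) * (2 + k) + (3 + k) * 2 ≡ (4 + k) * (3 + k)
  eq = solve-∀

-- If t R is the number of facets above a ridge R, then 3t ≤ t² + 2, and summing over all ridges
-- gives an equality because two facets share at most one ridge.  Hence t ≤ 2 and any two facets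
-- do share a ridge, which forces all facets into the union of any two of them.
module Extremal {n} (T : Tolerance n) (k : ℕ)
  (clean : ∀ x → 4 + k ≤ Tolerance.size T x → Tolerance.Clean T x)
  -- With m = 3 + k, the facets have m - 1 elements and the ridges m - 2. Their numbers are those of
  -- the boundary of a simplex on m vertices, m and C(m,2), the latter doubled to avoid a division.
  (#facets : Tolerance.faces T (_≤? 3 + k) (2 + k) ≡ 3 + k)
  (#ridges : Tolerance.faces T (_≤? 3 + k) (1 + k) * 2 ≡ (3 + k) * (2 + k))
  where

  open Tolerance T

  Facet Ridge : Subset n → Set
  Facet S = ∣ S ∣ ≡ 2 + k × Face (_≤ 3 + k) S
  Ridge S = ∣ S ∣ ≡ 1 + k × Face (_≤ 3 + k) S

  facet? : ∀ S → Dec (Facet S)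
  facet? S = (∣ S ∣ ≟ 2 + k) ×-dec face? (_≤? 3 + k) S

  ridge? : ∀ S → Dec (Ridge S)
  ridge? S = (∣ S ∣ ≟ 1 + k) ×-dec face? (_≤? 3 + k) S

  Ridge-⊆ : ∀ {R S} → Facet S → R ⊆ S → ∣ R ∣ ≡ 1 + k → Ridge R
  Ridge-⊆ (_ , x , q , x∉S , S⊆) R⊆S e = e , x , q , x∉S ∘ R⊆S , λ w∈ → S⊆ (R⊆S w∈)

  all : List (Subset n)
  all = subsets n

  F w : Subset n → ℕ
  F S = ⟦ facet? S ⟧
  w R = ⟦ ridge? R ⟧

  F-local : ∀ {a b} S → (Facet S → a ≡ b) → F S * a ≡ F S * b
  F-local S e with facet? S
  ... | yes f = cong (1 *_) (e f)
  ... | no _ = refl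

  F-local-≤ : ∀ {a b} S → (Facet S → a ≤ b) → F S * a ≤ F S * b
  F-local-≤ S e with facet? S
  ... | yes f = *-monoʳ-≤ 1 (e f)
  ... | no _ = z≤n

  F-cancel : ∀ {a b S} → Facet S → F S * a ≡ F S * b → a ≡ b
  F-cancel {a} {b} {S} f e rewrite ⟦⟧≡1 (facet? S) f =
    trans (sym (*-identityˡ a)) (trans e (*-identityˡ b))

  t : Subset n → ℕ
  t R = ∑ all λ S → F S * ⟦ R ⊆? S ⟧

  #common : Subset n → Subset n → ℕ
  #common S S′ = ∑ all λ R → w R * (⟦ R ⊆? S ⟧ * ⟦ R ⊆? S′ ⟧)

  -- Every subset of a facet with one element fewer is a ridge, so it suffices to count subsets.
  w⊆≡ : ∀ {S} → Facet S → ∑ all (λ R → w R * ⟦ R ⊆? S ⟧) ≡ 2 + k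
  w⊆≡ {S} f = begin
    ∑ all (λ R → w R * ⟦ R ⊆? S ⟧)
      ≡⟨ ∑-cong all (λ R → trans (sym (⟦⟧-× (ridge? R) (R ⊆? S)))
           (⟦⟧-cong (ridge? R ×-dec (R ⊆? S)) ((∣ R ∣ ≟ 1 + k) ×-dec (R ⊆? S))
           (λ { ((e , _) , R⊆S) → e , R⊆S }) (λ { (e , R⊆S) → Ridge-⊆ f R⊆S e , R⊆S }))) ⟩
    ∑ all (λ R → ⟦ (∣ R ∣ ≟ 1 + k) ×-dec (R ⊆? S) ⟧)
      ≡⟨ ∑-subsets-C S (1 + k) ⟩
    ∣ S ∣ C (1 + k)
      ≡⟨ cong (_C (1 + k)) (proj₁ f) ⟩
    (2 + k) C (1 + k)
      ≡⟨ [2+k]C[1+k]≡2+k k ⟩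
    2 + k ∎
    where open ≡-Reasoning

  -- Double count of the incidences between ridges and facets.
  ∑wt : ∑ all (λ R → w R * t R) ≡ (3 + k) * (2 + k)
  ∑wt = begin
    ∑ all (λ R → w R * t R)
      ≡⟨ ∑-cong all (λ R → sym (∑-*ˡ all (w R) _)) ⟩
    ∑ all (λ R → ∑ all (λ S → w R * (F S * ⟦ R ⊆? S ⟧)))
      ≡⟨ ∑-swap all all _ ⟩
    ∑ all (λ S → ∑ all (λ R → w R * (F S * ⟦ R ⊆? S ⟧)))
      ≡⟨ ∑-cong all (λ S → ∑-cong all λ R → eq (w R) (F S) _) ⟩
    ∑ all (λ S → ∑ all (λ R → F S * (w R * ⟦ R ⊆? S ⟧)))
      ≡⟨ ∑-cong all (λ S → trans (∑-*ˡ all (F S) _) (F-local S w⊆≡)) ⟩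
    ∑ all (λ S → F S * (2 + k))
      ≡⟨ ∑-*ʳ all (2 + k) F ⟩
    ∑ all F * (2 + k)
      ≡⟨ cong (_* (2 + k)) #facets ⟩
    (3 + k) * (2 + k) ∎
    where
    open ≡-Reasoning
    eq : ∀ a b c → a * (b * c) ≡ b * (a * c)
    eq = solve-∀

  -- Both sides count the triples of a ridge and an ordered pair of facets above it.
  ∑wt² : ∑ all (λ R → w R * (t R * t R)) ≡ ∑ all (λ S → F S * ∑ all (λ S′ → F S′ * #common S S′))
  ∑wt² = begin
    ∑ all (λ R → w R * (t R * t R))
      ≡⟨ ∑-cong all (λ R → trans (cong (w R *_) (sym (∑-*ʳ all (t R) _))) (sym (∑-*ˡ all (w R) _))) ⟩
    ∑ all (λ R → ∑ all (λ S → w R * (F S * ⟦ R ⊆? S ⟧ * t R)))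
      ≡⟨ ∑-swap all all _ ⟩
    ∑ all (λ S → ∑ all (λ R → w R * (F S * ⟦ R ⊆? S ⟧ * t R)))
      ≡⟨ ∑-cong all (λ S → trans (∑-cong all λ R → eq (w R) (F S) _ (t R)) (∑-*ˡ all (F S) _)) ⟩
    ∑ all (λ S → F S * ∑ all (λ R → w R * ⟦ R ⊆? S ⟧ * t R))
      ≡⟨ ∑-cong all (λ S → cong (F S *_) (∑-cong all λ R → sym (∑-*ˡ all (w R * ⟦ R ⊆? S ⟧) _))) ⟩
    ∑ all (λ S → F S * ∑ all (λ R → ∑ all (λ S′ → w R * ⟦ R ⊆? S ⟧ * (F S′ * ⟦ R ⊆? S′ ⟧))))
      ≡⟨ ∑-cong all (λ S → cong (F S *_) (∑-swap all all _)) ⟩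
    ∑ all (λ S → F S * ∑ all (λ S′ → ∑ all (λ R → w R * ⟦ R ⊆? S ⟧ * (F S′ * ⟦ R ⊆? S′ ⟧))))
      ≡⟨ ∑-cong all (λ S → cong (F S *_) (∑-cong all λ S′ →
           trans (∑-cong all λ R → eq′ (w R) _ (F S′) _) (∑-*ˡ all (F S′) _))) ⟩
    ∑ all (λ S → F S * ∑ all (λ S′ → F S′ * #common S S′)) ∎
    where
    open ≡-Reasoning
    eq : ∀ a b c d → a * (b * c * d) ≡ b * (a * c * d)
    eq = solve-∀
    eq′ : ∀ a b c d → a * b * (c * d) ≡ c * (a * (b * d))
    eq′ = solve-∀

  #common≤C : ∀ S S′ → #common S S′ ≤ ∣ S ∩ S′ ∣ C (1 + k)
  #common≤C S S′ = ≤-trans (∑-mono all λ R → ≤-trans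
    (≤-reflexive (sym (trans (⟦⟧-× (ridge? R) _) (cong (w R *_) (⟦⟧-× (R ⊆? S) (R ⊆? S′))))))
    (⟦⟧-mono (ridge? R ×-dec (R ⊆? S) ×-dec (R ⊆? S′)) ((∣ R ∣ ≟ 1 + k) ×-dec (R ⊆? S ∩ S′))
      λ { ((e , _) , R⊆S , R⊆S′) → e , λ x∈ → x∈p∩q⁺ (R⊆S x∈ , R⊆S′ x∈) }))
    (≤-reflexive (∑-subsets-C (S ∩ S′) (1 + k)))

  ∣∩∣≤1+k : ∀ {S S′} → Facet S → Facet S′ → S ≢ S′ → ∣ S ∩ S′ ∣ ≤ 1 + k
  ∣∩∣≤1+k {S} {S′} (e , _) (e′ , _) S≢S′ with 2 + k ≤? ∣ S ∩ S′ ∣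
  ... | no ≱ = ≤-pred (≰⇒> ≱)
  ... | yes ge = contradiction (trans (sym S∩S′≡S) S∩S′≡S′) S≢S′
    where
    S∩S′≡S : S ∩ S′ ≡ S
    S∩S′≡S = p⊆q∧∣q∣≤∣p∣⇒p≡q (p∩q⊆p S S′) (≤-trans (≤-reflexive e) ge)
    S∩S′≡S′ : S ∩ S′ ≡ S′
    S∩S′≡S′ = p⊆q∧∣q∣≤∣p∣⇒p≡q (p∩q⊆q S S′) (≤-trans (≤-reflexive e′) ge)

  i≤j⇒iCj≤1 : ∀ {i j} → i ≤ j → i C j ≤ 1
  i≤j⇒iCj≤1 {i} {j} i≤j with m≤n⇒m<n∨m≡n i≤j
  ... | inj₁ i<j = ≤-trans (≤-reflexive (k>n⇒nCk≡0 i<j)) z≤n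
  ... | inj₂ refl = ≤-reflexive (nCn≡1 i)

  -- The value is 2 + k on the diagonal, since a facet has that many ridges, and 1 off it.
  bound : Subset n → Subset n → ℕ
  bound S S′ = 1 + (1 + k) * ⟦ S′ ≟ˢ S ⟧

  #common≤bound : ∀ S S′ → Facet S → Facet S′ → #common S S′ ≤ bound S S′
  #common≤bound S S′ f f′ with S′ ≟ˢ S
  ... | yes refl = ≤-trans (∑-mono all λ R → *-monoʳ-≤ (w R)
      (≤-trans (*-monoʳ-≤ ⟦ R ⊆? S ⟧ (⟦⟧≤1 (R ⊆? S))) (≤-reflexive (*-identityʳ _))))
      (≤-reflexive (trans (w⊆≡ f) (cong suc (sym (*-identityʳ (1 + k))))))
    where
    ⟦⟧≤1 : (p? : Dec P) → ⟦ p? ⟧ ≤ 1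
    ⟦⟧≤1 (yes _) = ≤-refl
    ⟦⟧≤1 (no _) = z≤n
  ... | no S′≢S = ≤-trans (#common≤C S S′)
      (≤-trans (i≤j⇒iCj≤1 (∣∩∣≤1+k f f′ (S′≢S ∘ sym))) (m≤m+n 1 _))

  -- The row of a facet contributes 1 for each of the 3 + k facets and 1 + k more on the diagonal,
  -- together 2(2 + k).
  ∑bound : ∑ all (λ S → F S * ∑ all (λ S′ → F S′ * bound S S′)) ≡ 2 * ((3 + k) * (2 + k))
  ∑bound = begin
    ∑ all (λ S → F S * ∑ all (λ S′ → F S′ * bound S S′))
      ≡⟨ ∑-cong all (λ S → F-local S (inner S)) ⟩
    ∑ all (λ S → F S * (4 + 2 * k))
      ≡⟨ ∑-*ʳ all (4 + 2 * k) F ⟩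
    ∑ all F * (4 + 2 * k)
      ≡⟨ cong (_* (4 + 2 * k)) #facets ⟩
    (3 + k) * (4 + 2 * k)
      ≡⟨ eq k ⟩
    2 * ((3 + k) * (2 + k)) ∎
    where
    open ≡-Reasoning
    eq : ∀ k → (3 + k) * (4 + 2 * k) ≡ 2 * ((3 + k) * (2 + k))
    eq = solve-∀
    eq₁ : ∀ a b c → a * (1 + c * b) ≡ a + c * (a * b)
    eq₁ = solve-∀
    eq₂ : ∀ k → 3 + k + (1 + k) ≡ 4 + 2 * k
    eq₂ = solve-∀
    Fδ : ∀ {S} → Facet S → ∀ S′ → F S′ * ⟦ S′ ≟ˢ S ⟧ ≡ ⟦ S′ ≟ˢ S ⟧
    Fδ f S′ = trans (sym (⟦⟧-× (facet? S′) (S′ ≟ˢ _)))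
      (⟦⟧-cong (facet? S′ ×-dec (S′ ≟ˢ _)) (S′ ≟ˢ _) proj₂ λ { refl → f , refl })
    inner : ∀ S → Facet S → ∑ all (λ S′ → F S′ * bound S S′) ≡ 4 + 2 * k
    inner S f = begin
      ∑ all (λ S′ → F S′ * bound S S′)
        ≡⟨ ∑-cong all (λ S′ → trans (eq₁ (F S′) ⟦ S′ ≟ˢ S ⟧ (1 + k))
             (cong (λ z → F S′ + (1 + k) * z) (Fδ f S′))) ⟩
      ∑ all (λ S′ → F S′ + (1 + k) * ⟦ S′ ≟ˢ S ⟧)
        ≡⟨ ∑-+ all F _ ⟩
      ∑ all F + ∑ all (λ S′ → (1 + k) * ⟦ S′ ≟ˢ S ⟧)
        ≡⟨ cong₂ _+_ #facets (trans (∑-*ˡ all (1 + k) _)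
             (trans (cong ((1 + k) *_) (∑-δ S)) (*-identityʳ (1 + k)))) ⟩
      3 + k + (1 + k)
        ≡⟨ eq₂ k ⟩
      4 + 2 * k ∎

  ∑w3t : ∑ all (λ R → w R * (3 * t R)) ≡ 3 * ((3 + k) * (2 + k))
  ∑w3t = trans (∑-cong all λ R → eq (w R) (t R)) (trans (∑-*ˡ all 3 _) (cong (3 *_) ∑wt))
    where
    eq : ∀ a b → a * (3 * b) ≡ 3 * (a * b)
    eq = solve-∀

  ∑w[t²+2] : ∑ all (λ R → w R * (t R * t R + 2)) ≡
    ∑ all (λ R → w R * (t R * t R)) + (3 + k) * (2 + k)
  ∑w[t²+2] = trans (∑-cong all λ R → *-distribˡ-+ (w R) (t R * t R) 2) (trans (∑-+ all _ _)
    (cong (∑ all (λ R → w R * (t R * t R)) +_) (trans (∑-*ʳ all 2 w) #ridges)))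

  F#common≤Fbound : ∀ S → F S * ∑ all (λ S′ → F S′ * #common S S′) ≤
                          F S * ∑ all (λ S′ → F S′ * bound S S′)
  F#common≤Fbound S =
    F-local-≤ S λ f → ∑-mono all λ S′ → F-local-≤ S′ λ f′ → #common≤bound S S′ f f′

  w3t≤w[t²+2] : ∀ R → w R * (3 * t R) ≤ w R * (t R * t R + 2)
  w3t≤w[t²+2] R = *-monoʳ-≤ (w R) (3t≤t²+2 (t R))

  -- Summed over the ridges, t² is at most the total of `bound`, so t² + 2 sums to at most 3(3 +
  -- k)(2 + k), which is the sum of 3t. Hence 3t = t² + 2 at every ridge.
  ridge-t≤2 : ∀ {R} → Ridge R → t R ≤ 2
  ridge-t≤2 {R} r = 3t≡t²+2⇒t≤2 (t R) (cancel (∑-rigid all w3t≤w[t²+2] total (∈-subsets R)))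
    where
    cancel : w R * (3 * t R) ≡ w R * (t R * t R + 2) → 3 * t R ≡ t R * t R + 2
    cancel e rewrite ⟦⟧≡1 (ridge? R) r =
      trans (sym (*-identityˡ (3 * t R))) (trans e (*-identityˡ (t R * t R + 2)))
    open ≤-Reasoning
    total : ∑ all (λ R → w R * (t R * t R + 2)) ≤ ∑ all (λ R → w R * (3 * t R))
    total = begin
      ∑ all (λ R → w R * (t R * t R + 2))                    ≡⟨ ∑w[t²+2] ⟩
      ∑ all (λ R → w R * (t R * t R)) + (3 + k) * (2 + k)    ≡⟨ cong (_+ _) ∑wt² ⟩
      ∑ all (λ S → F S * ∑ all (λ S′ → F S′ * #common S S′)) + (3 + k) * (2 + k)
        ≤⟨ +-monoˡ-≤ ((3 + k) * (2 + k)) (∑-mono all F#common≤Fbound) ⟩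
      ∑ all (λ S → F S * ∑ all (λ S′ → F S′ * bound S S′)) + (3 + k) * (2 + k)
        ≡⟨ cong (_+ (3 + k) * (2 + k)) ∑bound ⟩
      2 * ((3 + k) * (2 + k)) + (3 + k) * (2 + k)            ≡⟨ +-comm (2 * ((3 + k) * (2 + k))) _ ⟩
      3 * ((3 + k) * (2 + k))                                ≡⟨ ∑w3t ⟨
      ∑ all (λ R → w R * (3 * t R))                          ∎

  -- The same chain of estimates, closed at its other end: the total of `bound` does not exceed that
  -- of `#common`, so two distinct facets have exactly one common ridge, and their intersection is
  -- large enough to contain it.
  facets-∩ : ∀ {S S′} → Facet S → Facet S′ → S ≢ S′ → ∣ S ∩ S′ ∣ ≡ 1 + k
  facets-∩ {S} {S′} f f′ S≢S′ = ≤-antisym (∣∩∣≤1+k f f′ S≢S′) 1+k≤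
    where
    open ≤-Reasoning
    total : ∑ all (λ S → F S * ∑ all (λ S′ → F S′ * bound S S′)) ≤
            ∑ all (λ S → F S * ∑ all (λ S′ → F S′ * #common S S′))
    total = +-cancelʳ-≤ ((3 + k) * (2 + k)) _ _ (begin
      ∑ all (λ S → F S * ∑ all (λ S′ → F S′ * bound S S′)) + (3 + k) * (2 + k)
        ≡⟨ cong (_+ (3 + k) * (2 + k)) ∑bound ⟩
      2 * ((3 + k) * (2 + k)) + (3 + k) * (2 + k)            ≡⟨ +-comm (2 * ((3 + k) * (2 + k))) _ ⟩
      3 * ((3 + k) * (2 + k))                                ≡⟨ ∑w3t ⟨
      ∑ all (λ R → w R * (3 * t R))                          ≤⟨ ∑-mono all w3t≤w[t²+2] ⟩
      ∑ all (λ R → w R * (t R * t R + 2))                    ≡⟨ ∑w[t²+2] ⟩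
      ∑ all (λ R → w R * (t R * t R)) + (3 + k) * (2 + k)    ≡⟨ cong (_+ _) ∑wt² ⟩
      ∑ all (λ S → F S * ∑ all (λ S′ → F S′ * #common S S′)) + (3 + k) * (2 + k) ∎)
    -- Tightness is used twice, first for the row of `S` and then for the entry of that row at `S′`.
    row : ∑ all (λ S′ → F S′ * #common S S′) ≡ ∑ all (λ S′ → F S′ * bound S S′)
    row = F-cancel f (∑-rigid all F#common≤Fbound total (∈-subsets S))
    #common≡bound : #common S S′ ≡ bound S S′
    #common≡bound = F-cancel f′ (∑-rigid all
      (λ S′ → F-local-≤ S′ λ f′ → #common≤bound S S′ f f′) (≤-reflexive (sym row)) (∈-subsets S′))
    1+k≤ : 1 + k ≤ ∣ S ∩ S′ ∣
    1+k≤ with 1 + k ≤? ∣ S ∩ S′ ∣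
    ... | yes le = le
    ... | no ≰ = contradiction
      (≤-trans (≤-reflexive (sym #common≡bound)) (≤-trans (#common≤C S S′)
        (≤-reflexive (k>n⇒nCk≡0 (≰⇒> ≰))))) λ ()

  other-facet : ∀ S → ∃ λ S′ → Facet S′ × S′ ≢ S
  other-facet S = ∑-witness all (λ S′ → facet? S′ ×-dec ¬? (S′ ≟ˢ S)) (≤-pred (begin
    2                                                           ≤⟨ m≤m+n 2 (1 + k) ⟩
    3 + k                                                       ≡⟨ #facets ⟨
    ∑ all F                                                     ≤⟨ ∑-mono all separate ⟩
    ∑ all (λ S′ → ⟦ S′ ≟ˢ S ⟧ + ⟦ facet? S′ ×-dec ¬? (S′ ≟ˢ S) ⟧) ≡⟨ ∑-+ all _ _ ⟩
    ∑ all (λ S′ → ⟦ S′ ≟ˢ S ⟧) + ∑ all (λ S′ → ⟦ facet? S′ ×-dec ¬? (S′ ≟ˢ S) ⟧)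
                                                                ≡⟨ cong (_+ ∑ all (λ S′ → ⟦ facet? S′ ×-dec ¬? (S′ ≟ˢ S) ⟧)) (∑-δ S) ⟩
    suc (∑ all (λ S′ → ⟦ facet? S′ ×-dec ¬? (S′ ≟ˢ S) ⟧))       ∎))
    where
    open ≤-Reasoning
    separate : ∀ S′ → F S′ ≤ ⟦ S′ ≟ˢ S ⟧ + ⟦ facet? S′ ×-dec ¬? (S′ ≟ˢ S) ⟧
    separate S′ = ≤-trans (≤-reflexive (⟦⟧-split (facet? S′) (S′ ≟ˢ S)))
      (+-monoˡ-≤ _ (⟦⟧-mono (facet? S′ ×-dec (S′ ≟ˢ S)) (S′ ≟ˢ S) proj₂))

  three-facets : ∀ {R S₁ S₂ S₃} → Facet S₁ → Facet S₂ → Facet S₃ →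
    S₂ ≢ S₁ → S₃ ≢ S₁ → S₃ ≢ S₂ → R ⊆ S₁ → R ⊆ S₂ → R ⊆ S₃ → 3 ≤ t R
  three-facets {R} {S₁} {S₂} {S₃} f₁ f₂ f₃ S₂≢S₁ S₃≢S₁ S₃≢S₂ R⊆S₁ R⊆S₂ R⊆S₃ = begin
    3
      ≡⟨ cong₂ _+_ (∑-δ S₁) (cong₂ _+_ (∑-δ S₂) (∑-δ S₃)) ⟨
    ∑ all (λ S → ⟦ S ≟ˢ S₁ ⟧) + (∑ all (λ S → ⟦ S ≟ˢ S₂ ⟧) + ∑ all (λ S → ⟦ S ≟ˢ S₃ ⟧))
      ≡⟨ cong (∑ all (λ S → ⟦ S ≟ˢ S₁ ⟧) +_) (∑-+ all _ _) ⟨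
    ∑ all (λ S → ⟦ S ≟ˢ S₁ ⟧) + ∑ all (λ S → ⟦ S ≟ˢ S₂ ⟧ + ⟦ S ≟ˢ S₃ ⟧)
      ≡⟨ ∑-+ all _ _ ⟨
    ∑ all (λ S → ⟦ S ≟ˢ S₁ ⟧ + (⟦ S ≟ˢ S₂ ⟧ + ⟦ S ≟ˢ S₃ ⟧))
      ≤⟨ ∑-mono all pointwise ⟩
    t R ∎
    where
    open ≤-Reasoning
    above : ∀ {S} → Facet S → R ⊆ S → F S * ⟦ R ⊆? S ⟧ ≡ 1
    above {S} f R⊆S = cong₂ _*_ (⟦⟧≡1 (facet? S) f) (⟦⟧≡1 (R ⊆? S) R⊆S)
    pointwise : ∀ S → ⟦ S ≟ˢ S₁ ⟧ + (⟦ S ≟ˢ S₂ ⟧ + ⟦ S ≟ˢ S₃ ⟧) ≤ F S * ⟦ R ⊆? S ⟧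
    pointwise S with S ≟ˢ S₁ | S ≟ˢ S₂ | S ≟ˢ S₃
    ... | yes refl | yes refl | _ = contradiction refl S₂≢S₁
    ... | yes refl | no _ | yes refl = contradiction refl S₃≢S₁
    ... | yes refl | no _ | no _ = ≤-reflexive (sym (above f₁ R⊆S₁))
    ... | no _ | yes refl | yes refl = contradiction refl S₃≢S₂
    ... | no _ | yes refl | no _ = ≤-reflexive (sym (above f₂ R⊆S₂))
    ... | no _ | no _ | yes refl = ≤-reflexive (sym (above f₃ R⊆S₃))
    ... | no _ | no _ | no _ = z≤n

  #through : Fin n → ℕ
  #through x = ∑ all λ S → F S * ⟦ x ∈? S ⟧

  ∣K─x∣ : ∀ {x s} → size x ≡ suc s → ∣ K x ─ ⁅ x ⁆ ∣ ≡ s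
  ∣K─x∣ {x} e = suc-injective (trans (x∈p⇒1+∣p─x∣≡∣p∣ (K-refl x)) e)

  -- The set `S` has 2 + k elements in `K x` and misses `x`, while `K x` has at most 3 + k elements;
  -- so nothing else is missed.
  Facet⇒K─x : ∀ {S} → Facet S → ∃ λ x → S ≡ K x ─ ⁅ x ⁆ × size x ≡ 3 + k
  Facet⇒K─x {S} (e , x , q , x∉S , S⊆) = x , p⊆q∧∣q∣≤∣p∣⇒p≡q
      (λ {w} w∈ → x∈p∧x∉q⇒x∈p─q (S⊆ w∈) λ w∈x → x∉S (subst (_∈ S) (x∈⁅y⁆⇒x≡y x w∈x) w∈))
      (≤-reflexive (trans (∣K─x∣ size≡) (sym e)))
    , size≡
    where
    size≡ : size x ≡ 3 + k
    size≡ = ≤-antisym q (≤-trans (≤-reflexive (cong suc (sym e))) (Face⇒∣S∣<size x∉S S⊆))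

  K─x-Facet : ∀ {x} → size x ≡ 3 + k → Facet (K x ─ ⁅ x ⁆)
  K─x-Facet {x} e = ∣K─x∣ e , x , ≤-reflexive e ,
    (λ x∈ → x∈p─q⇒x∉q (K x) ⁅ x ⁆ x∈ (x∈⁅x⁆ x)) , p─q⊆p (K x) ⁅ x ⁆

  -- A facet through `x` is `K u ─ ⁅ u ⁆` for some `u` in `K x` other than `x`, and it is determined
  -- by `u`.
  #through≤pred : ∀ x → #through x ≤ ∣ K x ─ ⁅ x ⁆ ∣
  #through≤pred x = begin
    #through x
      ≤⟨ ∑-mono all pointwise ⟩
    ∑ all (λ S → ∑ (allFin n) (λ u → ⟦ u ∈? K x ─ ⁅ x ⁆ ⟧ * ⟦ S ≟ˢ K u ─ ⁅ u ⁆ ⟧))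
      ≡⟨ ∑-swap all (allFin n) _ ⟩
    ∑ (allFin n) (λ u → ∑ all (λ S → ⟦ u ∈? K x ─ ⁅ x ⁆ ⟧ * ⟦ S ≟ˢ K u ─ ⁅ u ⁆ ⟧))
      ≡⟨ ∑-cong (allFin n) (λ u → trans (∑-*ˡ all ⟦ u ∈? K x ─ ⁅ x ⁆ ⟧ _)
           (trans (cong (⟦ u ∈? K x ─ ⁅ x ⁆ ⟧ *_) (∑-δ (K u ─ ⁅ u ⁆))) (*-identityʳ _))) ⟩
    ∑ (allFin n) (λ u → ⟦ u ∈? K x ─ ⁅ x ⁆ ⟧)
      ≡⟨ ∑-card (K x ─ ⁅ x ⁆) ⟩
    ∣ K x ─ ⁅ x ⁆ ∣ ∎
    where
    open ≤-Reasoning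
    pointwise : ∀ S → F S * ⟦ x ∈? S ⟧ ≤
      ∑ (allFin n) (λ u → ⟦ u ∈? K x ─ ⁅ x ⁆ ⟧ * ⟦ S ≟ˢ K u ─ ⁅ u ⁆ ⟧)
    pointwise S with facet? S | x ∈? S
    ... | no _ | _ = z≤n
    ... | yes _ | no _ = z≤n
    ... | yes f | yes x∈S with Facet⇒K─x f
    ... | u , refl , _ = ≤-trans
      (≤-reflexive (sym (cong₂ _*_ (⟦⟧≡1 (u ∈? K x ─ ⁅ x ⁆) u∈) (⟦⟧≡1 (S ≟ˢ S) refl))))
      (∑-member (λ u′ → ⟦ u′ ∈? K x ─ ⁅ x ⁆ ⟧ * ⟦ S ≟ˢ K u′ ─ ⁅ u′ ⁆ ⟧) (∈-allFin u))
      where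
      u∈ : u ∈ K x ─ ⁅ x ⁆
      u∈ = x∈p∧x∉q⇒x∈p─q (K-sym (p─q⊆p (K u) ⁅ u ⁆ x∈S)) λ u∈x →
        x∈p─q⇒x∉q (K u) ⁅ u ⁆ x∈S
          (subst (_∈ ⁅ u ⁆) (x∈⁅y⁆⇒x≡y x u∈x) (x∈⁅x⁆ u))

  -- The witness of a facet through `x` would lie in the clean class `K x` and so have the same size
  -- as `x`, which is too large.
  #through-big : ∀ x → 4 + k ≤ size x → #through x ≡ 0
  #through-big x big = ∑-zero all pointwise
    where
    pointwise : ∀ S → F S * ⟦ x ∈? S ⟧ ≡ 0
    pointwise S with facet? S | x ∈? S
    ... | no _ | _ = refl
    ... | yes _ | no _ = refl
    ... | yes (_ , u , q , _ , S⊆) | yes x∈S = contradiction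
      (subst (_≤ 3 + k) (cong ∣_∣ (clean x big (K-sym (S⊆ x∈S)))) q) (<⇒≱ big)

  #through≤2+k : ∀ x → #through x ≤ 2 + k
  #through≤2+k x with size x ≤? 3 + k
  ... | no ≰ = ≤-trans (≤-reflexive (#through-big x (≰⇒> ≰))) z≤n
  ... | yes le = ≤-trans (#through≤pred x)
    (≤-pred (≤-trans (≤-reflexive (x∈p⇒1+∣p─x∣≡∣p∣ (K-refl x))) le))

  #through-full : ∀ x → #through x ≡ 2 + k → size x ≡ 3 + k
  #through-full x e with size x ≤? 3 + k
  ... | no ≰ = contradiction (trans (sym e) (#through-big x (≰⇒> ≰))) λ ()
  ... | yes le = ≤-antisym le (≤-trans
    (s≤s (≤-trans (≤-reflexive (sym e)) (#through≤pred x))) (≤-reflexive (x∈p⇒1+∣p─x∣≡∣p∣ (K-refl x))))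

  module _ {S₁ S₂} (f₁ : Facet S₁) (f₂ : Facet S₂) (S₂≢S₁ : S₂ ≢ S₁) where

    M : Subset n
    M = S₁ ∪ S₂

    ∣M∣ : ∣ M ∣ ≡ 3 + k
    ∣M∣ = +-cancelʳ-≡ (1 + k) _ _ (begin
      ∣ M ∣ + (1 + k)        ≡⟨ cong (∣ M ∣ +_) (facets-∩ f₁ f₂ (S₂≢S₁ ∘ sym)) ⟨
      ∣ M ∣ + ∣ S₁ ∩ S₂ ∣    ≡⟨ ∣p∪q∣+∣p∩q∣≡∣p∣+∣q∣ S₁ S₂ ⟩
      ∣ S₁ ∣ + ∣ S₂ ∣        ≡⟨ cong₂ _+_ (proj₁ f₁) (proj₁ f₂) ⟩
      2 + k + (2 + k)        ≡⟨ eq k ⟩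
      3 + k + (1 + k)        ∎)
      where
      open ≡-Reasoning
      eq : ∀ k → 2 + k + (2 + k) ≡ 3 + k + (1 + k)
      eq = solve-∀

    -- A third facet cannot contain the ridge `S₁ ∩ S₂`, which already has two facets above it, so
    -- the triple intersection has at most k elements. By inclusion and exclusion the intersections
    -- of `S₃` with `S₁` and `S₂`, of 1 + k elements each, then cover all of `S₃`.
    facet⊆M : ∀ {S₃} → Facet S₃ → S₃ ⊆ M
    facet⊆M {S₃} f₃ with S₃ ≟ˢ S₁ | S₃ ≟ˢ S₂
    ... | yes refl | _ = p⊆p∪q S₂
    ... | no _ | yes refl = q⊆p∪q S₁ S₂
    ... | no S₃≢S₁ | no S₃≢S₂ = λ x∈ → p∩q⊆q S₃ M (subst (_ ∈_) (sym S₃∩M≡S₃) x∈)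
      where
      S₁₂ : Subset n
      S₁₂ = S₁ ∩ S₂
      ∣S₁₂∣ : ∣ S₁₂ ∣ ≡ 1 + k
      ∣S₁₂∣ = facets-∩ f₁ f₂ (S₂≢S₁ ∘ sym)
      S₁₂⊈S₃ : ¬ S₁₂ ⊆ S₃
      S₁₂⊈S₃ S₁₂⊆S₃ = <⇒≱ (three-facets f₁ f₂ f₃ S₂≢S₁ S₃≢S₁ S₃≢S₂ (p∩q⊆p S₁ S₂) (p∩q⊆q S₁ S₂) S₁₂⊆S₃)
        (ridge-t≤2 (Ridge-⊆ f₁ (p∩q⊆p S₁ S₂) ∣S₁₂∣))
      triple⊆S₁₂ : (S₃ ∩ S₁) ∩ (S₃ ∩ S₂) ⊆ S₁₂ ∩ S₃
      triple⊆S₁₂ x∈ with x∈p∩q⁻ (S₃ ∩ S₁) (S₃ ∩ S₂) x∈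
      ... | x∈₁ , x∈₂ = x∈p∩q⁺
        (x∈p∩q⁺ (p∩q⊆q S₃ S₁ x∈₁ , p∩q⊆q S₃ S₂ x∈₂) , p∩q⊆p S₃ S₁ x∈₁)
      ∣triple∣≤k : ∣ (S₃ ∩ S₁) ∩ (S₃ ∩ S₂) ∣ ≤ k
      ∣triple∣≤k with 1 + k ≤? ∣ S₁₂ ∩ S₃ ∣
      ... | no ≰ = ≤-trans (p⊆q⇒∣p∣≤∣q∣ triple⊆S₁₂) (≤-pred (≰⇒> ≰))
      ... | yes le = contradiction (λ {x} x∈ → p∩q⊆q S₁₂ S₃ (subst (x ∈_) (sym S₁₂∩S₃≡S₁₂) x∈)) S₁₂⊈S₃
        where
        S₁₂∩S₃≡S₁₂ : S₁₂ ∩ S₃ ≡ S₁₂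
        S₁₂∩S₃≡S₁₂ = p⊆q∧∣q∣≤∣p∣⇒p≡q (p∩q⊆p S₁₂ S₃) (≤-trans (≤-reflexive ∣S₁₂∣) le)
      open ≤-Reasoning
      eq : ∀ k → 2 + k + k ≡ 1 + k + (1 + k)
      eq = solve-∀
      S₃∩M≡S₃ : S₃ ∩ M ≡ S₃
      S₃∩M≡S₃ = p⊆q∧∣q∣≤∣p∣⇒p≡q (p∩q⊆p S₃ M) (+-cancelʳ-≤ k _ _ (begin
        ∣ S₃ ∣ + k                 ≡⟨ cong (_+ k) (proj₁ f₃) ⟩
        2 + k + k                  ≡⟨ eq k ⟩
        1 + k + (1 + k)            ≡⟨ cong₂ _+_ (facets-∩ f₃ f₁ S₃≢S₁) (facets-∩ f₃ f₂ S₃≢S₂) ⟨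
        ∣ S₃ ∩ S₁ ∣ + ∣ S₃ ∩ S₂ ∣  ≡⟨ ∣p∪q∣+∣p∩q∣≡∣p∣+∣q∣ (S₃ ∩ S₁) (S₃ ∩ S₂) ⟨
        ∣ (S₃ ∩ S₁) ∪ (S₃ ∩ S₂) ∣ + ∣ (S₃ ∩ S₁) ∩ (S₃ ∩ S₂) ∣
          ≡⟨ cong (λ p → ∣ p ∣ + ∣ (S₃ ∩ S₁) ∩ (S₃ ∩ S₂) ∣) (∩-distribˡ-∪ S₃ S₁ S₂) ⟨
        ∣ S₃ ∩ M ∣ + ∣ (S₃ ∩ S₁) ∩ (S₃ ∩ S₂) ∣  ≤⟨ +-monoʳ-≤ ∣ S₃ ∩ M ∣ ∣triple∣≤k ⟩
        ∣ S₃ ∩ M ∣ + k             ∎))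

    -- A vertex x lies in at most size x − 1 ≤ 2 + k facets, and on average over M in 2 + k of them.
    ∑through : ∑ (allFin n) (λ x → ⟦ x ∈? M ⟧ * #through x) ≡ (3 + k) * (2 + k)
    ∑through = begin
      ∑ (allFin n) (λ x → ⟦ x ∈? M ⟧ * #through x)
        ≡⟨ ∑-cong (allFin n) (λ x → sym (∑-*ˡ all ⟦ x ∈? M ⟧ _)) ⟩
      ∑ (allFin n) (λ x → ∑ all (λ S → ⟦ x ∈? M ⟧ * (F S * ⟦ x ∈? S ⟧)))
        ≡⟨ ∑-swap (allFin n) all _ ⟩
      ∑ all (λ S → ∑ (allFin n) (λ x → ⟦ x ∈? M ⟧ * (F S * ⟦ x ∈? S ⟧)))
        ≡⟨ ∑-cong all (λ S → trans (∑-cong (allFin n) λ x → eq ⟦ x ∈? M ⟧ (F S) _)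
             (∑-*ˡ (allFin n) (F S) _)) ⟩
      ∑ all (λ S → F S * ∑ (allFin n) (λ x → ⟦ x ∈? M ⟧ * ⟦ x ∈? S ⟧))
        ≡⟨ ∑-cong all (λ S → F-local S (within S)) ⟩
      ∑ all (λ S → F S * (2 + k))
        ≡⟨ ∑-*ʳ all (2 + k) F ⟩
      ∑ all F * (2 + k)
        ≡⟨ cong (_* (2 + k)) #facets ⟩
      (3 + k) * (2 + k) ∎
      where
      open ≡-Reasoning
      eq : ∀ a b c → a * (b * c) ≡ b * (a * c)
      eq = solve-∀
      within : ∀ S → Facet S → ∑ (allFin n) (λ x → ⟦ x ∈? M ⟧ * ⟦ x ∈? S ⟧) ≡ 2 + k
      within S f = trans (∑-cong (allFin n) λ x → trans (sym (⟦⟧-× (x ∈? M) (x ∈? S)))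
        (⟦⟧-cong ((x ∈? M) ×-dec (x ∈? S)) (x ∈? S) proj₂ λ x∈ → facet⊆M f x∈ , x∈))
        (trans (∑-card S) (proj₁ f))

    -- No vertex lies in more than 2 + k facets and the average over `M` attains this value, so
    -- every member of `M` attains it.
    size-M : ∀ {x} → x ∈ M → size x ≡ 3 + k
    size-M {x} x∈M = #through-full x (cancel (∑-rigid (allFin n)
      (λ x → *-monoʳ-≤ ⟦ x ∈? M ⟧ (#through≤2+k x)) total (∈-allFin x)))
      where
      cancel : ⟦ x ∈? M ⟧ * #through x ≡ ⟦ x ∈? M ⟧ * (2 + k) → #through x ≡ 2 + k
      cancel e rewrite ⟦⟧≡1 (x ∈? M) x∈M =
        trans (sym (*-identityˡ (#through x))) (trans e (*-identityˡ (2 + k)))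
      total : ∑ (allFin n) (λ x → ⟦ x ∈? M ⟧ * (2 + k)) ≤
              ∑ (allFin n) (λ x → ⟦ x ∈? M ⟧ * #through x)
      total = ≤-reflexive (trans (∑-*ʳ (allFin n) (2 + k) _)
        (trans (cong (_* (2 + k)) (trans (∑-card M) ∣M∣)) (sym ∑through)))

    -- Without `x` itself, `K x` is a facet and hence inside `M`; the cardinalities agree.
    K≡M : ∀ {x} → x ∈ M → K x ≡ M
    K≡M {x} x∈M = p⊆q∧∣q∣≤∣p∣⇒p≡q K⊆M (≤-reflexive (trans ∣M∣ (sym (size-M x∈M))))
      where
      K⊆M : K x ⊆ M
      K⊆M {y} y∈ with y ∈? ⁅ x ⁆
      ... | yes y∈x = subst (_∈ M) (sym (x∈⁅y⁆⇒x≡y x y∈x)) x∈M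
      ... | no y∉x = facet⊆M (K─x-Facet (size-M x∈M)) (x∈p∧x∉q⇒x∈p─q y∈ y∉x)

    -- Here `K x ─ ⁅ x ⁆` is a nonempty facet inside `M`, so `x` is related to some `y` in `M`, and
    -- `K y` is `M`.
    extremal∈M : ∀ {x} → size x ≡ 3 + k → x ∈ M
    extremal∈M {x} e =
      let y , y∈ = ∣p∣>0⇒Nonempty (≤-trans (s≤s z≤n) (≤-reflexive (sym (∣K─x∣ e))))
          y∈M = facet⊆M (K─x-Facet e) y∈
      in subst (x ∈_) (K≡M y∈M) (K-sym (p─q⊆p (K x) ⁅ x ⁆ y∈))

  one-class : ∃ λ M → ∣ M ∣ ≡ 3 + k × (∀ {x} → size x ≡ 3 + k → x ∈ M) × (∀ {x} → x ∈ M → K x ≡ M)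
  one-class =
    let S₁ , f₁ = ∑-witness all facet? (≤-trans (s≤s z≤n) (≤-reflexive (sym #facets)))
        S₂ , f₂ , S₂≢S₁ = other-facet S₁
    in M f₁ f₂ S₂≢S₁ , ∣M∣ f₁ f₂ S₂≢S₁ , extremal∈M f₁ f₂ S₂≢S₁ , K≡M f₁ f₂ S₂≢S₁

  extremal-clean : ∀ x → size x ≡ 3 + k → Clean x
  extremal-clean x e y∈ =
    let M , _ , ∈M , K≡M = one-class
    in trans (K≡M (subst (_ ∈_) (K≡M (∈M e)) y∈)) (sym (K≡M (∈M e)))

  extremal-count : count (_≟ 3 + k) ≡ 3 + k
  extremal-count =
    let M , ∣M∣ , ∈M , K≡M = one-class
    in trans (∑-cong (allFin n) λ x → ⟦⟧-cong (size x ≟ 3 + k) (x ∈? M)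
         ∈M (λ x∈ → trans (cong ∣_∣ (K≡M x∈)) ∣M∣))
       (trans (∑-card M) ∣M∣)

-- Comparison of two graphs, from large classes to small ones

module _ {n} (T : Tolerance n) where
  open Tolerance T

  count-positive : count (1 ≤?_) ≡ n
  count-positive = trans (∑-cong (allFin n) λ x → ⟦⟧-cong (1 ≤? size x) (x ∈? ⊤ {n})
    (λ _ → ∈⊤) (λ _ → size>0 x)) (trans (∑-card (⊤ {n})) (∣⊤∣≡n n))

  faces-top : ∀ i → faces (_≤? suc i) i ≡ faces (_≟ suc i) i
  faces-top i = ∑-cong (subsets n) λ S → ⟦⟧-cong
    ((∣ S ∣ ≟ i) ×-dec face? (_≤? suc i) S) ((∣ S ∣ ≟ i) ×-dec face? (_≟ suc i) S)
    (λ { (refl , x , q , x∉S , S⊆) → refl , x , ≤-antisym q (Face⇒∣S∣<size x∉S S⊆) , x∉S , S⊆ })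
    (λ { (e , x , q , r) → e , x , ≤-reflexive q , r })

  -- A vertex of size i + 1 would produce the face `K x ─ ⁅ x ⁆`.
  faces-top≡0 : ∀ i → faces (_≟ suc i) i ≡ 0 → ∀ x → size x ≢ suc i
  faces-top≡0 i e x size≡ = <⇒≢ (≤-trans (≤-reflexive (sym (⟦⟧≡1 (face′? (K x ─ ⁅ x ⁆)) face)))
    (∑-member (λ S → ⟦ face′? S ⟧) (∈-subsets (K x ─ ⁅ x ⁆)))) (sym e)
    where
    face′? : ∀ S → Dec (∣ S ∣ ≡ i × Face (_≡ suc i) S)
    face′? S = (∣ S ∣ ≟ i) ×-dec face? (_≟ suc i) S
    face : ∣ K x ─ ⁅ x ⁆ ∣ ≡ i × Face (_≡ suc i) (K x ─ ⁅ x ⁆)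
    face = suc-injective (trans (x∈p⇒1+∣p─x∣≡∣p∣ (K-refl x)) size≡) , x , size≡ ,
      (λ x∈ → x∈p─q⇒x∉q (K x) ⁅ x ⁆ x∈ (x∈⁅x⁆ x)) , p─q⊆p (K x) ⁅ x ⁆

  clean-1 : ∀ x → size x ≡ 1 → Clean x
  clean-1 x e {y} y∈ = cong K (x∈⁅y⁆⇒x≡y x (subst (y ∈_) (sym ⁅x⁆≡K) y∈))
    where
    ⁅x⁆≡K : ⁅ x ⁆ ≡ K x
    ⁅x⁆≡K = p⊆q∧∣q∣≤∣p∣⇒p≡q (λ w∈ → subst (_∈ K x) (sym (x∈⁅y⁆⇒x≡y x w∈)) (K-refl x))
      (≤-reflexive (trans e (sym (∣⁅x⁆∣≡1 x))))

  -- For `K x` equal to {x, y}, the set `K y` contains both points. Were it larger, it would be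
  -- clean and equal to `K x`; so it is the same pair.
  clean-2 : (∀ x → 3 ≤ size x → Clean x) → ∀ x → size x ≡ 2 → Clean x
  clean-2 clean x e {y} y∈ with y ≟ᶠ x
  ... | yes refl = refl
  ... | no y≢x = trans (sym (pair≡K y∈y y∈x size-y)) (pair≡K y∈ (K-refl x) (≤-reflexive e))
    where
    y∈x : x ∈ K y
    y∈x = K-sym y∈
    y∈y : y ∈ K y
    y∈y = K-refl y
    size-y : size y ≤ 2
    size-y with 3 ≤? size y
    ... | no ≱ = ≤-pred (≰⇒> ≱)
    ... | yes big = contradiction
      (≤-trans big (≤-reflexive (trans (sym (cong ∣_∣ (clean y big y∈x))) e))) λ { (s≤s (s≤s ())) }
    disjoint : ∣ ⁅ y ⁆ ∩ ⁅ x ⁆ ∣ ≡ 0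
    disjoint with 1 ≤? ∣ ⁅ y ⁆ ∩ ⁅ x ⁆ ∣
    ... | no ≱ = n<1⇒n≡0 (≰⇒> ≱)
    ... | yes le with ∣p∣>0⇒Nonempty le
    ... | z , z∈ with x∈p∩q⁻ ⁅ y ⁆ ⁅ x ⁆ z∈
    ... | z∈y , z∈x = contradiction (trans (sym (x∈⁅y⁆⇒x≡y y z∈y)) (x∈⁅y⁆⇒x≡y x z∈x)) y≢x
    ∣pair∣ : ∣ ⁅ y ⁆ ∪ ⁅ x ⁆ ∣ ≡ 2
    ∣pair∣ = trans (sym (+-identityʳ _)) (trans (cong (∣ ⁅ y ⁆ ∪ ⁅ x ⁆ ∣ +_) (sym disjoint))
      (trans (∣p∪q∣+∣p∩q∣≡∣p∣+∣q∣ ⁅ y ⁆ ⁅ x ⁆) (cong₂ _+_ (∣⁅x⁆∣≡1 y) (∣⁅x⁆∣≡1 x))))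
    pair≡K : ∀ {z} → y ∈ K z → x ∈ K z → size z ≤ 2 → ⁅ y ⁆ ∪ ⁅ x ⁆ ≡ K z
    pair≡K {z} y∈ x∈ le = p⊆q∧∣q∣≤∣p∣⇒p≡q (λ w∈ → pair⊆ (x∈p∪q⁻ ⁅ y ⁆ ⁅ x ⁆ w∈))
      (≤-trans le (≤-reflexive (sym ∣pair∣)))
      where
      pair⊆ : ∀ {w} → w ∈ ⁅ y ⁆ ⊎ w ∈ ⁅ x ⁆ → w ∈ K z
      pair⊆ (inj₁ w∈) = subst (_∈ K z) (sym (x∈⁅y⁆⇒x≡y y w∈)) y∈
      pair⊆ (inj₂ w∈) = subst (_∈ K z) (sym (x∈⁅y⁆⇒x≡y x w∈)) x∈

AllClean : Tolerance n → Set
AllClean T = ∀ x → Clean x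
  where open Tolerance T

-- For clean `T`: a class size m ≥ 3 occurs only once, and m - 1 does not occur, because `y ∈ K x`
-- would give both vertices the same size.
SeparatedSizes : Tolerance n → Set
SeparatedSizes T =
  ∀ x y → 3 ≤ size x → size y ≡ size x ⊎ suc (size y) ≡ size x → y ∈ K x
  where open Tolerance T

SameFaces : Tolerance n → Tolerance m → Set
SameFaces T T′ =
  ∀ i → 1 ≤ i → Tolerance.faces T (0 ≤?_) i ≡ Tolerance.faces T′ (0 ≤?_) i

module Comparison {n} (T T′ : Tolerance n)
  (G-clean : AllClean T) (G-sizes : SeparatedSizes T) (same-faces : SameFaces T T′) where

  module G = Tolerance T
  module H = Tolerance T′

  -- The invariant of the descent: sizes from m upwards come from classes in both relations, and
  -- these classes, their vertices and their nonempty faces have been matched in number.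
  record Agree (m : ℕ) : Set where
    field
      clean     : ∀ x → m ≤ H.size x → H.Clean x
      classes   : ∀ j → m ≤ j → G.count (_≟ j) ≡ H.count (_≟ j)
      vertices≥ : G.count (m ≤?_) ≡ H.count (m ≤?_)
      faces≥    : ∀ i → 1 ≤ i → G.faces (m ≤?_) i ≡ H.faces (m ≤?_) i

  open Agree

  agree-top : Agree (suc n)
  agree-top = record
    { clean     = λ x big → contradiction (∣p∣≤n (H.K x)) (<⇒≱ big)
    ; classes   = λ j big → trans
        (∑-zero (allFin n) λ x → ⟦⟧≡0 (G.size x ≟ j) λ { refl → <⇒≱ big (∣p∣≤n (G.K x)) })
        (sym (∑-zero (allFin n) λ x → ⟦⟧≡0 (H.size x ≟ j) λ { refl → <⇒≱ big (∣p∣≤n (H.K x)) }))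
    ; vertices≥ = trans
        (∑-zero (allFin n) λ x → ⟦⟧≡0 (suc n ≤? G.size x) λ big → <⇒≱ big (∣p∣≤n (G.K x)))
        (sym (∑-zero (allFin n) λ x → ⟦⟧≡0 (suc n ≤? H.size x) λ big → <⇒≱ big (∣p∣≤n (H.K x))))
    ; faces≥    = λ i _ → trans
        (G.faces≡0 (suc n ≤?_) i λ x big → contradiction (∣p∣≤n (G.K x)) (<⇒≱ big))
        (sym (H.faces≡0 (suc n ≤?_) i λ x big → contradiction (∣p∣≤n (H.K x)) (<⇒≱ big)))
    }

  module _ (m : ℕ) where

    ≤⇒<⊎≡ : ∀ s → m ≤ s → suc m ≤ s ⊎ s ≡ m
    ≤⇒<⊎≡ s m≤s = Sum.map₂ sym (m≤n⇒m<n∨m≡n m≤s)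

    ≡⇒≤ : ∀ s → s ≡ m → m ≤ s
    ≡⇒≤ s e = ≤-reflexive (sym e)

    <∧≡⇒⊥ : ∀ s → ¬ (suc m ≤ s × s ≡ m)
    <∧≡⇒⊥ s (lt , e) = <⇒≢ lt (sym e)

    module Split {k} (X : Tolerance k) where
      open Tolerance X

      vertices-split : count (m ≤?_) ≡ count (suc m ≤?_) + count (_≟ m)
      vertices-split =
        count-⊎ (suc m ≤?_) (_≟ m) (m ≤?_) ≤⇒<⊎≡ (λ _ → <⇒≤) ≡⇒≤ <∧≡⇒⊥

      module _ (cl : ∀ x → suc m ≤ size x → Clean x) where

        faces-split : ∀ i → 1 ≤ i → faces (m ≤?_) i ≡ faces (suc m ≤?_) i + faces (_≟ m) i
        faces-split = faces-⊎ (suc m ≤?_) (_≟ m) (m ≤?_) ≤⇒<⊎≡ (λ _ → <⇒≤) ≡⇒≤ <∧≡⇒⊥ cl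

        faces-low : ∀ i → 1 ≤ i → faces (0 ≤?_) i ≡ faces (suc m ≤?_) i + faces (_≤? m) i
        faces-low = faces-⊎ (suc m ≤?_) (_≤? m) (0 ≤?_)
          (λ s _ → Sum.swap (≤-<-connex s m)) (λ _ _ → z≤n) (λ _ _ → z≤n)
          (λ { _ (lt , le) → <⇒≱ lt le }) cl

    module SG = Split T
    module SH = Split T′

    module _ (A : Agree (suc m)) where

      -- Faces at the larger sizes are already matched and cancel from the totals.
      low-faces : ∀ i → 1 ≤ i → G.faces (_≤? m) i ≡ H.faces (_≤? m) i
      low-faces i 1≤i = +-cancelˡ-≡ (G.faces (suc m ≤?_) i) _ _
        (trans (sym (SG.faces-low (λ x _ → G-clean x) i 1≤i)) (trans (same-faces i 1≤i)
        (trans (SH.faces-low (clean A) i 1≤i) (cong (_+ H.faces (_≤? m) i) (sym (faces≥ A i 1≤i))))))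

      -- For clean neighbourhoods of size m, `faces-clean` determines the number of faces from the
      -- number of vertices: m is cancelled from the double count for i < m, and there are no faces
      -- for i ≥ m.
      agree-down : 1 ≤ m → (∀ x → H.size x ≡ m → H.Clean x) → G.count (_≟ m) ≡ H.count (_≟ m) →
        Agree m
      agree-down 1≤m clean-m count-m = record
        { clean     = λ x le → [ clean A x , clean-m x ]′ (≤⇒<⊎≡ _ le)
        ; classes   = λ j le → [ classes A j , (λ { refl → count-m }) ]′ (≤⇒<⊎≡ j le)
        ; vertices≥ = trans SG.vertices-split
            (trans (cong₂ _+_ (vertices≥ A) count-m) (sym SH.vertices-split))
        ; faces≥    = λ i 1≤i → trans (SG.faces-split (λ x _ → G-clean x) i 1≤i)
            (trans (cong₂ _+_ (faces≥ A i 1≤i) (faces-m i 1≤i))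
              (sym (SH.faces-split (clean A) i 1≤i)))
        }
        where
        instance
          _ = >-nonZero 1≤m
        faces-m : ∀ i → 1 ≤ i → G.faces (_≟ m) i ≡ H.faces (_≟ m) i
        faces-m i 1≤i with suc i ≤? m
        ... | yes i<m = *-cancelʳ-≡ _ _ m (trans (G.faces-clean m i (λ x _ → G-clean x) 1≤i i<m)
          (trans (cong (_* (m C i)) count-m) (sym (H.faces-clean m i clean-m 1≤i i<m))))
        ... | no i≮m = trans (G.faces≡0 (_≟ m) i λ { _ refl → m≤i })
          (sym (H.faces≡0 (_≟ m) i λ { _ refl → m≤i }))
          where
          m≤i : m ≤ i
          m≤i = ≤-pred (≰⇒> i≮m)

  -- A class of size 1 has no nonempty face and cannot be detected by faces. Its vertices are what
  -- remains of the common total of n.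
  agree-1 : Agree 2 → Agree 1
  agree-1 A = agree-down 1 A ≤-refl (clean-1 T′) (+-cancelˡ-≡ (G.count (2 ≤?_)) _ _
    (trans (sym (SG.vertices-split 1)) (trans (count-positive T) (trans (sym (count-positive T′))
    (trans (SH.vertices-split 1) (cong (_+ H.count (_≟ 1)) (sym (vertices≥ A))))))))

  -- Several classes of size 2 may occur. They are clean by `clean-2`, and the faces with one
  -- element count their vertices.
  agree-2 : Agree 3 → Agree 2
  agree-2 A = agree-down 2 A (s≤s z≤n) cl (*-cancelʳ-≡ _ _ 2
    (trans (sym (G.faces-clean 2 1 (λ x _ → G-clean x) ≤-refl ≤-refl))
    (trans (cong (_* 2) (trans (sym (faces-top T 1))
      (trans (low-faces 2 A 1 ≤-refl) (faces-top T′ 1))))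
    (H.faces-clean 2 1 cl ≤-refl ≤-refl))))
    where
    cl : ∀ x → H.size x ≡ 2 → H.Clean x
    cl = clean-2 T′ (clean A)

  -- If size m = 3 + k is absent from `G`, there are no remaining faces with m - 1 elements, which
  -- excludes it from `H`. If it is present, separation gives the numbers of facets and ridges that
  -- `Extremal` requires.
  agree-3+ : ∀ k → Agree (4 + k) → Agree (3 + k)
  agree-3+ k A with any? (λ x → G.size x ≟ 3 + k)
  ... | no none = agree-down (3 + k) A (s≤s z≤n) (λ x e → contradiction e (H-none x))
    (trans G≡0 (sym (∑-zero (allFin n) λ x → ⟦⟧≡0 (H.size x ≟ 3 + k) (H-none x))))
    where
    G≡0 : G.count (_≟ 3 + k) ≡ 0
    G≡0 = ∑-zero (allFin n) λ x → ⟦⟧≡0 (G.size x ≟ 3 + k) λ e → none (x , e)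
    G-faces≡0 : G.faces (_≟ 3 + k) (2 + k) ≡ 0
    G-faces≡0 = *-cancelʳ-≡ _ 0 (3 + k) (trans
      (G.faces-clean (3 + k) (2 + k) (λ x _ → G-clean x) (s≤s z≤n) ≤-refl)
      (cong (_* ((3 + k) C (2 + k))) G≡0))
    H-none : ∀ x → H.size x ≢ 3 + k
    H-none = faces-top≡0 T′ (2 + k) (trans (sym (faces-top T′ (2 + k)))
      (trans (sym (low-faces (3 + k) A (2 + k) (s≤s z≤n)))
      (trans (faces-top T (2 + k)) G-faces≡0)))
  ... | yes (x , e) = agree-down (3 + k) A (s≤s z≤n) extremal-clean (trans G-count (sym extremal-count))
    where
    3≤x : 3 ≤ G.size x
    3≤x = ≤-trans (m≤m+n 3 k) (≤-reflexive (sym e))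
    G-count : G.count (_≟ 3 + k) ≡ 3 + k
    G-count = trans (∑-cong (allFin n) λ y → ⟦⟧-cong (G.size y ≟ 3 + k) (y ∈? G.K x)
        (λ e′ → G-sizes x y 3≤x (inj₁ (trans e′ (sym e))))
        (λ y∈ → trans (cong ∣_∣ (G-clean x y∈)) e))
      (trans (∑-card (G.K x)) e)
    G-faces : ∀ i → 1 ≤ i → i <ⁿ 3 + k → G.faces (_≟ 3 + k) i ≡ (3 + k) C i
    G-faces i 1≤i i<m = *-cancelʳ-≡ _ _ (3 + k) (trans
      (G.faces-clean (3 + k) i (λ x _ → G-clean x) 1≤i i<m)
      (trans (cong (_* ((3 + k) C i)) G-count) (*-comm (3 + k) ((3 + k) C i))))
    no-predecessor : ∀ y → G.size y ≢ 2 + k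
    no-predecessor y e′ = 1+n≢n (trans (sym (trans (cong ∣_∣ (G-clean x y∈)) e)) e′)
      where
      y∈ : y ∈ G.K x
      y∈ = G-sizes x y 3≤x (inj₂ (trans (cong suc e′) (sym e)))
    -- A witness of a ridge has size at least m - 1, and separation excludes m - 1 itself.
    ridges : G.faces (_≤? 3 + k) (1 + k) ≡ G.faces (_≟ 3 + k) (1 + k)
    ridges = ∑-cong (subsets n) λ S → ⟦⟧-cong
      ((∣ S ∣ ≟ 1 + k) ×-dec G.face? (_≤? 3 + k) S) ((∣ S ∣ ≟ 1 + k) ×-dec G.face? (_≟ 3 + k) S)
      (λ { (e , y , q , y∉S , S⊆) → e , y , ≤-antisym q
             (≤∧≢⇒< (subst (_<ⁿ G.size y) e (G.Face⇒∣S∣<size y∉S S⊆)) (no-predecessor y ∘ sym)) , y∉S , S⊆ })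
      (λ { (e , y , q , r) → e , y , ≤-reflexive q , r })
    open Extremal T′ k (clean A)
      (trans (sym (low-faces (3 + k) A (2 + k) (s≤s z≤n))) (trans (faces-top T (2 + k))
        (trans (G-faces (2 + k) (s≤s z≤n) ≤-refl) ([2+k]C[1+k]≡2+k (suc k)))))
      (trans (cong (_* 2) (trans (sym (low-faces (3 + k) A (1 + k) (s≤s z≤n)))
        (trans ridges (G-faces (1 + k) (s≤s z≤n) (n≤1+n (2 + k))))))
        ([3+k]C[1+k]*2≡[3+k]*[2+k] k))

  agree : ∀ d m → d + m ≡ n → Agree (suc m)
  agree zero m refl = agree-top
  agree (suc d) m e = step m (agree d (suc m) (trans (+-suc d m) e))
    where
    step : ∀ m → Agree (2 + m) → Agree (suc m)
    step 0 = agree-1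
    step 1 = agree-2
    step (suc (suc k)) = agree-3+ k

  H-clean : ∀ x → H.Clean x
  H-clean x = clean (agree n 0 (+-identityʳ n)) x (H.size>0 x)

  same-classes : ∀ j → G.count (_≟ j) ≡ H.count (_≟ j)
  same-classes zero = trans
    (∑-zero (allFin n) λ x → ⟦⟧≡0 (G.size x ≟ 0) λ e → <⇒≢ (G.size>0 x) (sym e))
    (sym (∑-zero (allFin n) λ x → ⟦⟧≡0 (H.size x ≟ 0) λ e → <⇒≢ (H.size>0 x) (sym e)))
  same-classes (suc j) = classes (agree n 0 (+-identityʳ n)) (suc j) (s≤s z≤n)

-- Isomorphism of equivalence relations with equal class counts

-- Greedy choice: each element of `p` takes an element of `q` that is still free. The argument in
-- `Fin m` is the default value outside `p`, which makes `g` total.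
subset-injection : (p : Subset n) (q : Subset m) → ∣ p ∣ ≤ ∣ q ∣ → Fin m →
  ∃ λ (g : Fin n → Fin m) → (∀ {x} → x ∈ p → g x ∈ q) ×
                            (∀ {x y} → x ∈ p → y ∈ p → g x ≡ g y → x ≡ y)
subset-injection [] q _ _ = (λ ()) , (λ ()) , λ {x} → λ ()
subset-injection {suc n} {m} (outside ∷ p) q le default =
  let g , g-into , g-inj = subset-injection p q le default
      extend : Fin (suc n) → Fin m
      extend = λ { zero → default ; (suc x) → g x }
  in extend , (λ { (there x∈) → g-into x∈ }) ,
     λ { (there x∈) (there y∈) e → cong suc (g-inj x∈ y∈ e) }
subset-injection {suc n} {m} (inside ∷ p) q le default =
  let z , z∈ = ∣p∣>0⇒Nonempty (≤-trans (s≤s z≤n) le)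
      g , g-into , g-inj = subset-injection p (q ─ ⁅ z ⁆)
        (≤-pred (≤-trans le (≤-reflexive (sym (x∈p⇒1+∣p─x∣≡∣p∣ z∈))))) default
      g≢z : ∀ {x} → x ∈ p → g x ≢ z
      g≢z x∈ e = x∈p─q⇒x∉q q ⁅ z ⁆ (g-into x∈) (subst (_∈ ⁅ z ⁆) (sym e) (x∈⁅x⁆ z))
      extend : Fin (suc n) → Fin m
      extend = λ { zero → z ; (suc x) → g x }
  in extend ,
     (λ { here → z∈ ; (there x∈) → p─q⊆p q ⁅ z ⁆ (g-into x∈) }) ,
     λ { here here _ → refl
       ; here (there y∈) e → contradiction (sym e) (g≢z y∈)
       ; (there x∈) here e → contradiction e (g≢z x∈)
       ; (there x∈) (there y∈) e → cong suc (g-inj x∈ y∈ e) }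

-- If `y` were missed, punching it out would inject `Fin (suc n)` into `Fin n`.
injective⇒surjective : ∀ {n} (f : Fin n → Fin n) → (∀ {x y} → f x ≡ f y → x ≡ y) →
  ∀ y → ∃ λ x → f x ≡ y
injective⇒surjective {suc n} f inj y with any? (λ x → f x ≟ᶠ y)
... | yes found = found
... | no none = contradiction
  (injective⇒≤ {f = λ x → punchOut (y≢f x)} λ {a} {b} e → inj (punchOut-injective (y≢f a) (y≢f b) e))
  1+n≰n
  where
  y≢f : ∀ x → y ≢ f x
  y≢f x e = none (x , sym e)

module Within {n} (T : Tolerance n) (clean : AllClean T) where

  open Tolerance T

  Closed : Subset n → Set
  Closed W = ∀ {x y} → x ∈ W → y ∈ K x → y ∈ W

  countIn : Subset n → ℕ → ℕ
  countIn W j = ∑ (allFin n) λ x → ⟦ (x ∈? W) ×-dec (size x ≟ j) ⟧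

  remove-Closed : ∀ {W} x → Closed W → Closed (W ─ K x)
  remove-Closed {W} x closed {y} {z} y∈ z∈ = x∈p∧x∉q⇒x∈p─q (closed (p─q⊆p W (K x) y∈) z∈)
    λ z∈x → x∈p─q⇒x∉q W (K x) y∈ (subst (y ∈_) (clean x z∈x) (K-sym z∈))

  countIn-remove : ∀ {W x} → Closed W → x ∈ W → ∀ j →
    countIn W j ≡ countIn (W ─ K x) j + ⟦ size x ≟ j ⟧ * size x
  countIn-remove {W} {x} closed x∈W j = trans
    (∑-cong (allFin n) λ y → ⟦⟧-⊎ ((y ∈? W ─ K x) ×-dec (size y ≟ j)) ((size x ≟ j) ×-dec (y ∈? K x))
      ((y ∈? W) ×-dec (size y ≟ j))
      (λ { (y∈W , refl) → decide y y∈W (y ∈? K x) })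
      (λ { (y∈ , e) → p─q⊆p W (K x) y∈ , e })
      (λ { (e , y∈) → closed x∈W y∈ , trans (cong ∣_∣ (clean x y∈)) e })
      (λ { ((y∈ , _) , (_ , y∈x)) → x∈p─q⇒x∉q W (K x) y∈ y∈x }))
    (trans (∑-+ (allFin n) _ _) (cong (countIn (W ─ K x) j +_)
      (trans (∑-cong (allFin n) λ y → ⟦⟧-× (size x ≟ j) (y ∈? K x))
        (trans (∑-*ˡ (allFin n) ⟦ size x ≟ j ⟧ _) (cong (⟦ size x ≟ j ⟧ *_) (∑-card (K x)))))))
    where
    decide : ∀ y → y ∈ W → Dec (y ∈ K x) →
      (y ∈ W ─ K x × size y ≡ size y) ⊎ (size x ≡ size y × y ∈ K x)
    decide y y∈W (yes y∈x) = inj₂ (sym (cong ∣_∣ (clean x y∈x)) , y∈x)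
    decide y y∈W (no y∉x) = inj₁ (x∈p∧x∉q⇒x∈p─q y∈W y∉x , refl)

module Matching {n} (T T′ : Tolerance n) (G-clean : AllClean T) (H-clean : AllClean T′) where

  module G = Tolerance T
  module H = Tolerance T′
  module GW = Within T G-clean
  module HW = Within T′ H-clean

  -- A total function constrained only on `W`, so that partial isomorphisms can be glued without
  -- changing their type.
  Match : Subset n → Subset n → Set
  Match W W′ = ∃ λ (f : Fin n → Fin n) →
    (∀ {x} → x ∈ W → f x ∈ W′) ×
    (∀ {x y} → x ∈ W → y ∈ W → f x ≡ f y → x ≡ y) ×
    (∀ {x y} → x ∈ W → y ∈ W → y ∈ G.K x ⇔ f y ∈ H.K (f x))

  -- Any injection between the classes `K x` and `K z` is glued to the given map on the rest. No
  -- pair is related across the gap on either side, since both removed sets are classes.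
  match-class : ∀ {W W′ x z} → GW.Closed W → HW.Closed W′ → x ∈ W → z ∈ W′ →
    G.size x ≡ H.size z → Match (W ─ G.K x) (W′ ─ H.K z) → Match W W′
  match-class {W} {W′} {x} {z} closed closed′ x∈W z∈W′ e (f , f-into , f-inj , f-rel) =
    h , (λ {a} a∈ → into a∈ (a ∈? G.K x)) ,
    (λ {a} {b} a∈ b∈ → inj a∈ b∈ (a ∈? G.K x) (b ∈? G.K x)) ,
    (λ {a} {b} a∈ b∈ → rel a∈ b∈ (a ∈? G.K x) (b ∈? G.K x))
    where
    g-data : ∃ λ (g : Fin n → Fin n) → (∀ {a} → a ∈ G.K x → g a ∈ H.K z) ×
                            (∀ {a b} → a ∈ G.K x → b ∈ G.K x → g a ≡ g b → a ≡ b)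
    g-data = subset-injection (G.K x) (H.K z) (≤-reflexive e) x
    g : Fin n → Fin n
    g = proj₁ g-data
    g-into : ∀ {a} → a ∈ G.K x → g a ∈ H.K z
    g-into = proj₁ (proj₂ g-data)

    choose : ∀ a → Dec (a ∈ G.K x) → Fin n
    choose a (yes _) = g a
    choose a (no _) = f a
    h : Fin n → Fin n
    h a = choose a (a ∈? G.K x)

    rest : ∀ {a} → a ∈ W → a ∉ G.K x → f a ∈ W′ ─ H.K z
    rest a∈ a∉ = f-into (x∈p∧x∉q⇒x∈p─q a∈ a∉)

    f∉ : ∀ {a} → a ∈ W → a ∉ G.K x → f a ∉ H.K z
    f∉ a∈ a∉ = x∈p─q⇒x∉q W′ (H.K z) (rest a∈ a∉)

    into : ∀ {a} → a ∈ W → (a? : Dec (a ∈ G.K x)) → choose a a? ∈ W′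
    into a∈ (yes a∈x) = closed′ z∈W′ (g-into a∈x)
    into a∈ (no a∉x) = p─q⊆p W′ (H.K z) (rest a∈ a∉x)

    inj : ∀ {a b} → a ∈ W → b ∈ W → (a? : Dec (a ∈ G.K x)) (b? : Dec (b ∈ G.K x)) →
      choose a a? ≡ choose b b? → a ≡ b
    inj a∈ b∈ (yes a∈x) (yes b∈x) = proj₂ (proj₂ g-data) a∈x b∈x
    inj a∈ b∈ (yes a∈x) (no b∉x) e = contradiction (subst (_∈ H.K z) e (g-into a∈x)) (f∉ b∈ b∉x)
    inj a∈ b∈ (no a∉x) (yes b∈x) e = contradiction (subst (_∈ H.K z) (sym e) (g-into b∈x)) (f∉ a∈ a∉x)
    inj a∈ b∈ (no a∉x) (no b∉x) = f-inj (x∈p∧x∉q⇒x∈p─q a∈ a∉x) (x∈p∧x∉q⇒x∈p─q b∈ b∉x)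

    rel : ∀ {a b} → a ∈ W → b ∈ W → (a? : Dec (a ∈ G.K x)) (b? : Dec (b ∈ G.K x)) →
      b ∈ G.K a ⇔ choose b b? ∈ H.K (choose a a?)
    rel {a} {b} a∈ b∈ (yes a∈x) (yes b∈x) = mk⇔
      (λ _ → subst (g b ∈_) (sym (H-clean z (g-into a∈x))) (g-into b∈x))
      (λ _ → subst (b ∈_) (sym (G-clean x a∈x)) b∈x)
    rel {a} {b} a∈ b∈ (yes a∈x) (no b∉x) = mk⇔
      (λ b∈a → contradiction (subst (b ∈_) (G-clean x a∈x) b∈a) b∉x)
      (λ fb∈ → contradiction (subst (f b ∈_) (H-clean z (g-into a∈x)) fb∈) (f∉ b∈ b∉x))
    rel {a} {b} a∈ b∈ (no a∉x) (yes b∈x) = mk⇔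
      (λ b∈a → contradiction (subst (a ∈_) (G-clean x b∈x) (G.K-sym b∈a)) a∉x)
      (λ gb∈ → contradiction (subst (f a ∈_) (H-clean z (g-into b∈x)) (H.K-sym gb∈)) (f∉ a∈ a∉x))
    rel a∈ b∈ (no a∉x) (no b∉x) = f-rel (x∈p∧x∉q⇒x∈p─q a∈ a∉x) (x∈p∧x∉q⇒x∈p─q b∈ b∉x)

  -- One class is removed at a time: equality of the counts at the size of `x` supplies a class of
  -- the same size in `W′`, and the counts of the remainders still agree. The number `s` bounds the
  -- recursion.
  match : ∀ s W W′ → ∣ W ∣ ≤ s → GW.Closed W → HW.Closed W′ →
    (∀ j → GW.countIn W j ≡ HW.countIn W′ j) → Match W W′
  match s W W′ le closed closed′ same with nonempty? W
  ... | no empty = id , (λ x∈ → contradiction (_ , x∈) empty) ,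
    (λ x∈ → contradiction (_ , x∈) empty) , (λ x∈ → contradiction (_ , x∈) empty)
  match zero W W′ le closed closed′ same | yes (x , x∈W) =
    contradiction (≤-trans (p⊆q⇒∣p∣≤∣q∣ {p = G.K x} (closed x∈W)) le) (<⇒≱ (G.size>0 x))
  match (suc s) W W′ le closed closed′ same | yes (x , x∈W)
    with ∑-witness (allFin n) (λ z → (z ∈? W′) ×-dec (H.size z ≟ G.size x))
      (≤-trans (≤-reflexive (sym (⟦⟧≡1 ((x ∈? W) ×-dec (G.size x ≟ G.size x)) (x∈W , refl))))
      (≤-trans (∑-member (λ y → ⟦ (y ∈? W) ×-dec (G.size y ≟ G.size x) ⟧) (∈-allFin x))
        (≤-reflexive (same (G.size x)))))
  ... | z , z∈W′ , e = match-class closed closed′ x∈W z∈W′ (sym e)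
    (match s (W ─ G.K x) (W′ ─ H.K z) smaller
      (GW.remove-Closed x closed) (HW.remove-Closed z closed′) same′)
    where
    smaller : ∣ W ─ G.K x ∣ ≤ s
    smaller = ≤-pred (≤-trans (p∩q≢∅⇒∣p─q∣<∣p∣ W (G.K x) (x , x∈p∩q⁺ (x∈W , G.K-refl x))) le)
    same′ : ∀ j → GW.countIn (W ─ G.K x) j ≡ HW.countIn (W′ ─ H.K z) j
    same′ j = +-cancelʳ-≡ (⟦ G.size x ≟ j ⟧ * G.size x) _ _
      (trans (sym (GW.countIn-remove closed x∈W j)) (trans (same j)
      (trans (HW.countIn-remove closed′ z∈W′ j)
        (cong (λ s → HW.countIn (W′ ─ H.K z) j + ⟦ s ≟ j ⟧ * s) e))))

  isomorphism : (∀ j → G.count (_≟ j) ≡ H.count (_≟ j)) →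
    Σ (Fin n ↔ Fin n) λ f → ∀ x y →
      y ∈ G.K x ⇔ Inverse.to f y ∈ H.K (Inverse.to f x)
  isomorphism same =
    mk↔ₛ′ f (proj₁ ∘ f-surj) (proj₂ ∘ f-surj) (λ x → f-inj (proj₂ (f-surj (f x)))) ,
    λ x y → f-rel ∈⊤ ∈⊤
    where
    total : ∀ {k} (X : Tolerance k) j →
      ∑ (allFin k) (λ x → ⟦ (x ∈? ⊤) ×-dec (Tolerance.size X x ≟ j) ⟧) ≡ Tolerance.count X (_≟ j)
    total {k} X j = ∑-cong (allFin k) λ x → ⟦⟧-cong ((x ∈? ⊤) ×-dec (Tolerance.size X x ≟ j))
      (Tolerance.size X x ≟ j) proj₂ (∈⊤ ,_)
    all-match : Match ⊤ ⊤
    all-match = match n ⊤ ⊤ (∣p∣≤n (⊤ {n})) (λ _ _ → ∈⊤) (λ _ _ → ∈⊤)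
      (λ j → trans (total T j) (trans (same j) (sym (total T′ j))))
    f : Fin n → Fin n
    f = proj₁ all-match
    f-inj : ∀ {x y} → f x ≡ f y → x ≡ y
    f-inj = proj₁ (proj₂ (proj₂ all-match)) ∈⊤ ∈⊤
    f-rel : ∀ {x y} → x ∈ ⊤ → y ∈ ⊤ → y ∈ G.K x ⇔ f y ∈ H.K (f x)
    f-rel = proj₂ (proj₂ (proj₂ all-match))
    f-surj : ∀ y → ∃ λ x → f x ≡ y
    f-surj = injective⇒surjective f f-inj

-- Non-dominating sets and the domination polynomial

fromPred : {P : Fin n → Set} → (∀ x → Dec (P x)) → Subset n
fromPred P? = Vec.tabulate (does ∘ P?)

∈-fromPred⁺ : {P : Fin n → Set} (P? : ∀ x → Dec (P x)) {x : Fin n} → P x → x ∈ fromPred P?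
∈-fromPred⁺ P? {x} p = lookup⇒[]= x _ (trans (lookup∘tabulate (does ∘ P?) x) (dec-true (P? x) p))

∈-fromPred⁻ : {P : Fin n → Set} (P? : ∀ x → Dec (P x)) {x : Fin n} → x ∈ fromPred P? → P x
∈-fromPred⁻ P? {x} x∈ =
  decidable-stable (P? x) λ ¬p → contradiction (trans (sym ([]=⇒lookup x∈))
    (trans (lookup∘tabulate (does ∘ P?) x) (dec-false (P? x) ¬p))) λ ()

nonadjacency : (G : Graph) → Tolerance (v G)
nonadjacency G = record
  { K      = λ x → fromPred (λ y → ¬? (adj? G x y))
  ; K-refl = λ x → ∈-fromPred⁺ (λ y → ¬? (adj? G x y)) (irrefl G refl)
  ; K-sym  = λ {x} {y} y∈ → ∈-fromPred⁺ (λ z → ¬? (adj? G y z))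
      (∈-fromPred⁻ (λ z → ¬? (adj? G x z)) y∈ ∘ symm G)
  }

module _ (G : Graph) where
  open Tolerance (nonadjacency G)

  ∈K⁺ : ∀ {x y} → ¬ Adj G x y → y ∈ K x
  ∈K⁺ {x} = ∈-fromPred⁺ (λ y → ¬? (adj? G x y))

  ∈K⁻ : ∀ {x y} → y ∈ K x → ¬ Adj G x y
  ∈K⁻ {x} = ∈-fromPred⁻ (λ y → ¬? (adj? G x y))

  Undominated : Subset (v G) → Set
  Undominated = Face (0 ≤_)

  #undominated : ℕ → ℕ
  #undominated = faces (0 ≤?_)

  Undominated⇒¬Dominating : ∀ S → Undominated S → ¬ Dominating G S
  Undominated⇒¬Dominating S (x , _ , x∉S , S⊆) dom with dom x
  ... | s , s∈ , inj₁ refl = x∉S s∈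
  ... | s , s∈ , inj₂ adj = ∈K⁻ (S⊆ s∈) (symm G adj)

  ¬Dominating⇒Undominated : ∀ S → ¬ Dominating G S → Undominated S
  ¬Dominating⇒Undominated S ¬dom
    with ¬∀⟶∃¬ (v G) _ (λ y → any? λ x → (x ∈? S) ×-dec ((y ≟ᶠ x) ⊎-dec adj? G x y)) ¬dom
  ... | y , none = y , z≤n , (λ y∈ → none (y , y∈ , inj₁ refl)) ,
    λ {s} s∈ → ∈K⁺ λ adj → none (s , s∈ , inj₂ (symm G adj))

  d≡∑ : ∀ i → d G i ≡ ∑ (subsets (v G)) λ S → ⟦ dominating? G S ×-dec (∣ S ∣ ≟ i) ⟧
  d≡∑ i = ∑-filter (λ S → dominating? G S ×-dec (∣ S ∣ ≟ i)) (subsets (v G))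

  d+#undominated : ∀ i → d G i + #undominated i ≡ ∑ (subsets (v G)) λ S → ⟦ ∣ S ∣ ≟ i ⟧
  d+#undominated i = trans (cong (_+ #undominated i) (d≡∑ i)) (sym (trans
    (∑-cong (subsets (v G)) λ S → ⟦⟧-⊎ (dominating? G S ×-dec (∣ S ∣ ≟ i))
      ((∣ S ∣ ≟ i) ×-dec face? (0 ≤?_) S) (∣ S ∣ ≟ i)
      (decide S) proj₂ proj₁ λ { ((dom , _) , (_ , u)) → Undominated⇒¬Dominating S u dom })
    (∑-+ (subsets (v G)) _ _)))
    where
    decide : ∀ S → ∣ S ∣ ≡ i → (Dominating G S × ∣ S ∣ ≡ i) ⊎ (∣ S ∣ ≡ i × Undominated S)
    decide S e with dominating? G S
    ... | yes dom = inj₁ (dom , e)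
    ... | no ¬dom = inj₂ (e , ¬Dominating⇒Undominated S ¬dom)

  d-witness : ∀ i → 1 ≤ d G i → i ≤ v G
  d-witness i 1≤d with ∑-witness (subsets (v G)) (λ S → dominating? G S ×-dec (∣ S ∣ ≟ i))
    (≤-trans 1≤d (≤-reflexive (d≡∑ i)))
  ... | S , _ , refl = ∣p∣≤n S

  d-full : 1 ≤ d G (v G)
  d-full = ≤-trans (≤-reflexive (sym (⟦⟧≡1 (dominating? G ⊤ ×-dec (∣ ⊤ {v G} ∣ ≟ v G))
      ((λ y → y , ∈⊤ , inj₁ refl) , ∣⊤∣≡n (v G)))))
    (≤-trans (∑-member (λ S → ⟦ dominating? G S ×-dec (∣ S ∣ ≟ v G) ⟧) (∈-subsets (⊤ {v G})))
      (≤-reflexive (sym (d≡∑ (v G)))))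

  coeff-D : ∀ i → coeff (D G) (suc i) ≡ d G (suc i)
  coeff-D i with suc i ≤? v G
  ... | yes i<v = coeff-applyUpTo (d G ∘ suc) i<v
    where
    coeff-applyUpTo : ∀ (f : ℕ → ℕ) {n i} → i <ⁿ n → coeff (applyUpTo f n) i ≡ f i
    coeff-applyUpTo f {suc n} {zero} _ = refl
    coeff-applyUpTo f {suc n} {suc i} (s≤s lt) = coeff-applyUpTo (f ∘ suc) lt
  ... | no i≮v = trans (coeff-beyond (d G ∘ suc) (≤-pred (≰⇒> i≮v)))
      (sym (n<1⇒n≡0 (≰⇒> λ 1≤d → i≮v (d-witness (suc i) 1≤d))))
    where
    coeff-beyond : ∀ (f : ℕ → ℕ) {n i} → n ≤ i → coeff (applyUpTo f n) i ≡ 0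
    coeff-beyond f {zero} _ = refl
    coeff-beyond f {suc n} {suc i} (s≤s le) = coeff-beyond (f ∘ suc) le

  Adj-stable : ∀ {x y} → ¬ ¬ Adj G x y → Adj G x y
  Adj-stable {x} {y} = decidable-stable (adj? G x y)

∑-size : (n ≡ m) → ∀ i → ∑ (subsets n) (λ S → ⟦ ∣ S ∣ ≟ i ⟧) ≡ ∑ (subsets m) (λ S → ⟦ ∣ S ∣ ≟ i ⟧)
∑-size refl i = refl

#undominated⇒d : ∀ G H → v G ≡ v H → ∀ i → #undominated G i ≡ #undominated H i → d G i ≡ d H i
#undominated⇒d G H e i same = +-cancelʳ-≡ (#undominated G i) _ _ (trans (d+#undominated G i)
  (trans (∑-size e i) (trans (sym (d+#undominated H i)) (cong (d H i +_) (sym same)))))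

d⇒#undominated : ∀ G H → v G ≡ v H → ∀ i → d G i ≡ d H i → #undominated G i ≡ #undominated H i
d⇒#undominated G H e i same = +-cancelˡ-≡ (d G i) _ _ (trans (d+#undominated G i)
  (trans (∑-size e i) (trans (sym (d+#undominated H i)) (cong (_+ #undominated H i) (sym same)))))

-- The two vertex counts are separate variables, so that matching on `refl` can identify them; the
-- direction from `T′` to `T` is that of `H ≅ G`.
tolerance-isomorphism : (T : Tolerance n) (T′ : Tolerance m) → m ≡ n →
  AllClean T → SeparatedSizes T → SameFaces T T′ →
  Σ (Fin m ↔ Fin n) λ f → ∀ x y →
    y ∈ Tolerance.K T′ x ⇔ Inverse.to f y ∈ Tolerance.K T (Inverse.to f x)
tolerance-isomorphism T T′ refl G-clean G-sizes same-faces =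
  Matching.isomorphism T′ T H-clean G-clean (λ j → sym (same-classes j))
  where open Comparison T T′ G-clean G-sizes same-faces

clean-D-unique : (G : Graph) → 1 ≤ v G →
  AllClean (nonadjacency G) → SeparatedSizes (nonadjacency G) → D-Unique G
clean-D-unique G 1≤v clean sizes H D≈ =
  let f , rel = tolerance-isomorphism (nonadjacency G) (nonadjacency H) v≡ clean sizes
        λ { (suc i) _ → d⇒#undominated G H (sym v≡) (suc i) (sym (d≡ i)) }
  in f , λ x y → mk⇔
       (λ adj → Adj-stable G λ ¬adj → ∈K⁻ H (Equivalence.from (rel x y) (∈K⁺ G ¬adj)) adj)
       (λ adj → Adj-stable H λ ¬adj → ∈K⁻ G (Equivalence.to (rel x y) (∈K⁺ H ¬adj)) adj)
  where
  d≡ : ∀ i → d H (suc i) ≡ d G (suc i)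
  d≡ i = trans (sym (coeff-D H i)) (trans (D≈ (suc i)) (coeff-D G i))
  -- The full vertex set dominates, so the number of vertices is the degree of the polynomial. The
  -- constant coefficient is always 0, hence `1 ≤ v X`.
  v≤ : ∀ X Y → 1 ≤ v X → (∀ i → d Y (suc i) ≡ d X (suc i)) → v X ≤ v Y
  v≤ X Y 1≤vX same = go (v X) refl 1≤vX
    where
    go : ∀ k → v X ≡ k → 1 ≤ k → k ≤ v Y
    go (suc k) e _ = d-witness Y (suc k)
      (≤-trans (subst (λ k → 1 ≤ d X k) e (d-full X)) (≤-reflexive (sym (same k))))
  vG≤vH : v G ≤ v H
  vG≤vH = v≤ G H 1≤v d≡
  v≡ : v H ≡ v G
  v≡ = ≤-antisym (v≤ H G (≤-trans 1≤v vG≤vH) (λ i → sym (d≡ i))) vG≤vH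

-- Complete multipartite graphs

index : ∀ {r} (a : Vec ℕ r) → Fin (Vec.sum a) → ℕ
index (m ∷ a) x = [ toℕ , index a ]′ (splitAt m x)

∑-↑ : ∀ m {n} (f : Fin (m + n) → ℕ) →
  ∑ (allFin (m + n)) f ≡ ∑ (allFin m) (λ x → f (x ↑ˡ n)) + ∑ (allFin n) (λ y → f (m ↑ʳ y))
∑-↑ zero f = refl
∑-↑ (suc m) {n} f = begin
  ∑ (allFin (suc m + n)) f
    ≡⟨ ∑-suc (m + n) f ⟩
  f zero + ∑ (allFin (m + n)) (f ∘ suc)
    ≡⟨ cong (f zero +_) (∑-↑ m (f ∘ suc)) ⟩
  f zero + (∑ (allFin m) (λ x → f (suc x ↑ˡ n)) + ∑ (allFin n) (λ y → f (suc m ↑ʳ y)))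
    ≡⟨ +-assoc (f zero) _ _ ⟨
  f zero + ∑ (allFin m) (λ x → f (suc x ↑ˡ n)) + ∑ (allFin n) (λ y → f (suc m ↑ʳ y))
    ≡⟨ cong (_+ ∑ (allFin n) (λ y → f (suc m ↑ʳ y))) (∑-suc m (λ x → f (x ↑ˡ n))) ⟨
  ∑ (allFin (suc m)) (λ x → f (x ↑ˡ n)) + ∑ (allFin n) (λ y → f (suc m ↑ʳ y)) ∎
  where open ≡-Reasoning

∑-toℕ< : ∀ m b → b ≤ m → ∑ (allFin m) (λ x → ⟦ toℕ x <? b ⟧) ≡ b
∑-toℕ< m zero _ = ∑-zero (allFin m) λ x → ⟦⟧≡0 (toℕ x <? 0) λ ()
∑-toℕ< (suc m) (suc b) (s≤s b≤m) = trans (∑-suc m λ x → ⟦ toℕ x <? suc b ⟧) (cong suc (trans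
  (∑-cong (allFin m) λ x → ⟦⟧-cong (suc (toℕ x) <? suc b) (toℕ x <? b) ≤-pred s≤s) (∑-toℕ< m b b≤m)))

inPrefix? : ∀ {r} (a : Vec ℕ r) (c : Fin r) (b : ℕ) →
  ∀ x → Dec (colour a x ≡ c × index a x <ⁿ b)
inPrefix? a c b x = (colour a x ≟ᶠ c) ×-dec (index a x <? b)

-- With `b` the full size this computes the class sizes; a proper prefix occurs as the set `R′` of
-- the rewiring.
∑-prefix : ∀ {r} (a : Vec ℕ r) c b → b ≤ lookup a c →
  ∑ (allFin (Vec.sum a)) (λ x → ⟦ inPrefix? a c b x ⟧) ≡ b
∑-prefix (m ∷ a) zero b b≤ = trans (∑-↑ m _) (trans (cong₂ _+_
  (trans (∑-cong (allFin m) λ x → ⟦⟧-cong (inPrefix? (m ∷ a) zero b (x ↑ˡ Vec.sum a)) (toℕ x <? b)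
    (λ { (_ , lt) → subst (λ z → [ toℕ , index a ]′ z <ⁿ b) (splitAt-↑ˡ m x _) lt })
    (λ lt → cong [ _ , _ ]′ (splitAt-↑ˡ m x _) ,
      subst (λ z → [ toℕ , index a ]′ z <ⁿ b) (sym (splitAt-↑ˡ m x _)) lt))
    (∑-toℕ< m b b≤))
  (∑-zero (allFin _) λ y → ⟦⟧≡0 (inPrefix? (m ∷ a) zero b (m ↑ʳ y))
    λ { (e , _) → contradiction (trans (sym e) (cong [ _ , _ ]′ (splitAt-↑ʳ m _ y))) λ () }))
  (+-identityʳ b))
∑-prefix (m ∷ a) (suc c) b b≤ = trans (∑-↑ m _) (cong₂ _+_
  (∑-zero (allFin m) λ x → ⟦⟧≡0 (inPrefix? (m ∷ a) (suc c) b (x ↑ˡ Vec.sum a))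
    λ { (e , _) → contradiction (trans (sym e) (cong [ _ , _ ]′ (splitAt-↑ˡ m x _))) λ () })
  (trans (∑-cong (allFin _) λ y → ⟦⟧-cong (inPrefix? (m ∷ a) (suc c) b (m ↑ʳ y)) (inPrefix? a c b y)
    (λ { (e , lt) → sucᶠ-injective
           (trans (sym (cong [ _ , _ ]′ (splitAt-↑ʳ m _ y))) e) ,
         subst (λ z → [ toℕ , index a ]′ z <ⁿ b) (splitAt-↑ʳ m _ y) lt })
    (λ { (e , lt) → trans (cong [ _ , _ ]′ (splitAt-↑ʳ m _ y)) (cong suc e) ,
         subst (λ z → [ toℕ , index a ]′ z <ⁿ b) (sym (splitAt-↑ʳ m _ y)) lt }))
    (∑-prefix a c b b≤)))

index<size : ∀ {r} (a : Vec ℕ r) x → index a x <ⁿ lookup a (colour a x)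
index<size (m ∷ a) x with splitAt m x
... | inj₁ y = toℕ<n y
... | inj₂ y = index<size a y

vertex : ∀ {r} (a : Vec ℕ r) c t → t <ⁿ lookup a c → ∃ λ x → colour a x ≡ c × index a x ≡ t
vertex (m ∷ a) zero t lt = fromℕ< lt ↑ˡ _ ,
  cong [ _ , _ ]′ (splitAt-↑ˡ m (fromℕ< lt) _) ,
  trans (cong [ _ , _ ]′ (splitAt-↑ˡ m (fromℕ< lt) _)) (toℕ-fromℕ< lt)
vertex (m ∷ a) (suc c) t lt =
  let x , e , e′ = vertex a c t lt
  in m ↑ʳ x , trans (cong [ _ , _ ]′ (splitAt-↑ʳ m _ x)) (cong suc e) ,
     trans (cong [ _ , _ ]′ (splitAt-↑ʳ m _ x)) e′

colour-index-injective : ∀ {r} (a : Vec ℕ r) {x y} →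
  colour a x ≡ colour a y → index a x ≡ index a y → x ≡ y
colour-index-injective (m ∷ a) {x} {y} e e′ with splitAt m x in eqx | splitAt m y in eqy
... | inj₁ x′ | inj₁ y′ = trans (sym (splitAt⁻¹-↑ˡ eqx))
  (trans (cong (_↑ˡ Vec.sum a) (toℕ-injective e′)) (splitAt⁻¹-↑ˡ eqy))
... | inj₂ x′ | inj₂ y′ = trans (sym (splitAt⁻¹-↑ʳ {m} eqx))
  (trans (cong (m ↑ʳ_) (colour-index-injective a (sucᶠ-injective e) e′))
    (splitAt⁻¹-↑ʳ {m} eqy))

module Multipartite {r} (a : Vec ℕ r) where

  open Tolerance (nonadjacency (𝒦 a)) public

  c : Fin (v (𝒦 a)) → Fin r
  c = colour a

  same-colour : ∀ {x y} → y ∈ K x → c x ≡ c y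
  same-colour {x} {y} y∈ = decidable-stable (c x ≟ᶠ c y) (∈K⁻ (𝒦 a) y∈)

  same-colour⁻ : ∀ {x y} → c x ≡ c y → y ∈ K x
  same-colour⁻ e = ∈K⁺ (𝒦 a) λ ne → ne e

  class-clean : ∀ x → Clean x
  class-clean x y∈ = ⊆-antisym
    (λ z∈ → same-colour⁻ (trans (same-colour y∈) (same-colour z∈)))
    (λ z∈ → same-colour⁻ (trans (sym (same-colour y∈)) (same-colour z∈)))

  ∣fromPred-prefix∣ : ∀ i b → b ≤ lookup a i → ∣ fromPred (inPrefix? a i b) ∣ ≡ b
  ∣fromPred-prefix∣ i b b≤ = trans (sym (∑-card (fromPred (inPrefix? a i b))))
    (trans (∑-cong (allFin _) λ x → ⟦⟧-cong (x ∈? fromPred (inPrefix? a i b)) (inPrefix? a i b x)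
      (∈-fromPred⁻ (inPrefix? a i b)) (∈-fromPred⁺ (inPrefix? a i b))) (∑-prefix a i b b≤))

  size≡lookup : ∀ x → size x ≡ lookup a (c x)
  size≡lookup x = trans (cong ∣_∣ K≡) (∣fromPred-prefix∣ (c x) _ ≤-refl)
    where
    prefix? : ∀ y → Dec (c y ≡ c x × index a y <ⁿ lookup a (c x))
    prefix? = inPrefix? a (c x) (lookup a (c x))
    K≡ : K x ≡ fromPred prefix?
    K≡ = ⊆-antisym
      (λ {y} y∈ → let e = sym (same-colour y∈) in
        ∈-fromPred⁺ prefix? (e , subst (λ i → index a y <ⁿ lookup a i) e (index<size a y)))
      (λ y∈ → same-colour⁻ (sym (proj₁ (∈-fromPred⁻ prefix? y∈))))

-- The two classes i and j, of sizes p ≤ q ≤ p + 1, get a bipartite non-adjacency graph: x in class i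
-- and y in class j are non-adjacent iff their indices differ.  If q = p the undominated sets stay the
-- same; if q = p + 1 they change only in that the first p vertices R′ of class j are replaced by the
-- whole class L = i, of the same cardinality.
module Twin {r} (a : Vec ℕ r) (i j : Fin r) (i≢j : i ≢ j)
  (p≤q : lookup a i ≤ lookup a j) (q≤1+p : lookup a j ≤ suc (lookup a i)) (3≤q : 3 ≤ lookup a j)
  where

  open Multipartite a using (c; same-colour; same-colour⁻; ∣fromPred-prefix∣)

  V : Set
  V = Fin (v (𝒦 a))

  p q : ℕ
  p = lookup a i
  q = lookup a j

  ix : V → ℕ
  ix = index a

  2≤p : 2 ≤ p
  2≤p = ≤-pred (≤-trans 3≤q q≤1+p)

  Cross Other Near : V → V → Set
  Cross x y = (c x ≡ i × c y ≡ j ⊎ c x ≡ j × c y ≡ i) × ix x ≢ ix y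
  Other x y = (c x ≢ i × c x ≢ j) × c x ≡ c y
  Near x y = x ≡ y ⊎ Cross x y ⊎ Other x y

  near? : ∀ x y → Dec (Near x y)
  near? x y = (x ≟ᶠ y) ⊎-dec
    ((((c x ≟ᶠ i) ×-dec (c y ≟ᶠ j)) ⊎-dec ((c x ≟ᶠ j) ×-dec (c y ≟ᶠ i))) ×-dec ¬? (ix x ≟ ix y)) ⊎-dec
    ((¬? (c x ≟ᶠ i) ×-dec ¬? (c x ≟ᶠ j)) ×-dec (c x ≟ᶠ c y))

  near-sym : ∀ {x y} → Near x y → Near y x
  near-sym (inj₁ e) = inj₁ (sym e)
  near-sym (inj₂ (inj₁ (inj₁ (e , e′) , ne))) = inj₂ (inj₁ (inj₂ (e′ , e) , ne ∘ sym))
  near-sym (inj₂ (inj₁ (inj₂ (e , e′) , ne))) = inj₂ (inj₁ (inj₁ (e′ , e) , ne ∘ sym))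
  near-sym (inj₂ (inj₂ ((ne , ne′) , e))) =
    inj₂ (inj₂ ((subst (_≢ i) e ne , subst (_≢ j) e ne′) , sym e))

  H : Graph
  H = record
    { v      = v (𝒦 a)
    ; Adj    = λ x y → ¬ Near x y
    ; adj?   = λ x y → ¬? (near? x y)
    ; symm   = λ ¬near near → ¬near (near-sym near)
    ; irrefl = λ { refl ¬near → ¬near (inj₁ refl) }
    }

  UG UH : Subset (v (𝒦 a)) → Set
  UG = Undominated (𝒦 a)
  UH = Undominated H

  UG-intro : ∀ {S} x → x ∉ S → (∀ {s} → s ∈ S → c x ≡ c s) → UG S
  UG-intro x x∉ f = x , z≤n , x∉ , λ s∈ → same-colour⁻ (f s∈)

  UH-intro : ∀ {S} x → x ∉ S → (∀ {s} → s ∈ S → Near x s) → UH S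
  UH-intro x x∉ f = x , z≤n , x∉ , λ s∈ → ∈K⁺ H λ ¬near → ¬near (f s∈)

  UH-near : ∀ {S} x → S ⊆ Tolerance.K (nonadjacency H) x → ∀ {s} → s ∈ S → Near x s
  UH-near x S⊆ s∈ = decidable-stable (near? x _) (∈K⁻ H (S⊆ s∈))

  left? right? : ∀ x → Dec _
  left? = inPrefix? a i p
  right? = inPrefix? a j p

  L R′ : Subset (v (𝒦 a))
  L = fromPred left?
  R′ = fromPred right?

  ∣L∣ : ∣ L ∣ ≡ p
  ∣L∣ = ∣fromPred-prefix∣ i p ≤-refl
  ∣R′∣ : ∣ R′ ∣ ≡ p
  ∣R′∣ = ∣fromPred-prefix∣ j p p≤q

  ∈L : ∀ {x} → c x ≡ i → x ∈ L
  ∈L {x} e = ∈-fromPred⁺ left? (e , subst (λ k → ix x <ⁿ lookup a k) e (index<size a x))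

  differ : ∀ {S x s} → x ∉ S → s ∈ S → c x ≡ c s → ix x ≢ ix s
  differ {S} x∉ s∈ e e′ = x∉ (subst (_∈ S) (sym (colour-index-injective a e e′)) s∈)

  missing : ∀ {S Q : Subset (v (𝒦 a))} → S ⊆ Q → S ≢ Q → ∃ λ z → z ∈ Q × z ∉ S
  missing {S} {Q} S⊆Q S≢Q = ∣p∣<∣q∣⇒∃∈q∖p S Q
    (≰⇒> λ le → S≢Q (p⊆q∧∣q∣≤∣p∣⇒p≡q S⊆Q le))

  -- For `x` in one of the two classes, the new witness is the vertex of the same index in the other
  -- one: in `H` it is non-adjacent to the whole class of `x` except `x`. From class j such a vertex
  -- exists only for an index below p, hence the last hypothesis.
  UG⇒UH : ∀ {S} x → x ∉ S → (∀ {s} → s ∈ S → c x ≡ c s) → (c x ≡ j → ix x <ⁿ p) → UH S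
  UG⇒UH {S} x x∉ f low with c x ≟ᶠ i | c x ≟ᶠ j
  ... | no ≢i | no ≢j = UH-intro x x∉ λ s∈ → inj₂ (inj₂ ((≢i , ≢j) , f s∈))
  ... | yes cx≡i | _ =
    let y , cy , iy = vertex a j (ix x)
          (<-≤-trans (subst (λ k → ix x <ⁿ lookup a k) cx≡i (index<size a x)) p≤q)
    in UH-intro y (λ y∈ → i≢j (trans (sym cx≡i) (trans (f y∈) cy)))
       λ s∈ → inj₂ (inj₁ (inj₂ (cy , trans (sym (f s∈)) cx≡i) ,
                          λ e → differ x∉ s∈ (f s∈) (trans (sym iy) e)))
  ... | no _ | yes cx≡j =
    let y , cy , iy = vertex a i (ix x) (low cx≡j)
    in UH-intro y (λ y∈ → i≢j (trans (sym cy) (trans (sym (f y∈)) cx≡j)))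
       λ s∈ → inj₂ (inj₁ (inj₁ (cy , trans (sym (f s∈)) cx≡j) ,
                          λ e → differ x∉ s∈ (f s∈) (trans (sym iy) e)))

  -- The only witness without a counterpart is the last vertex of class j when q = p + 1. Then `S`
  -- lies in `R′`, and unless it is all of `R′`, a vertex of `R′` outside `S` is a witness that has
  -- one.
  forward : ∀ {S} → UG S → (q ≤ p ⊎ S ≢ R′) → UH S
  forward {S} (x , _ , x∉ , S⊆) ok with (c x ≟ᶠ j) ×-dec (p ≤? ix x)
  ... | no ok′ = UG⇒UH x x∉ (λ s∈ → same-colour (S⊆ s∈)) λ e → ≰⇒> λ le → ok′ (e , le)
  ... | yes (cx≡j , p≤ix) = fix ok
    where
    ix<q : ∀ {y} → c y ≡ j → ix y <ⁿ q
    ix<q {y} e = subst (λ k → ix y <ⁿ lookup a k) e (index<size a y)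
    cs≡j : ∀ {s} → s ∈ S → c s ≡ j
    cs≡j s∈ = trans (sym (same-colour (S⊆ s∈))) cx≡j
    ix≡p : ∀ {y} → c y ≡ j → p ≤ ix y → ix y ≡ p
    ix≡p e le = ≤-antisym (≤-pred (<-≤-trans (ix<q e) q≤1+p)) le
    S⊆R′ : S ⊆ R′
    S⊆R′ s∈ = ∈-fromPred⁺ right? (cs≡j s∈ , ≰⇒> λ le → differ x∉ s∈ (same-colour (S⊆ s∈))
      (trans (ix≡p cx≡j p≤ix) (sym (ix≡p (cs≡j s∈) le))))
    fix : q ≤ p ⊎ S ≢ R′ → UH S
    fix (inj₁ q≤p) = contradiction (<-≤-trans (ix<q cx≡j) q≤p) (≤⇒≯ p≤ix)
    fix (inj₂ S≢R′) =
      let z , z∈ , z∉ = missing S⊆R′ S≢R′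
          cz , iz = ∈-fromPred⁻ right? z∈
      in UG⇒UH z z∉ (λ s∈ → trans cz (sym (cs≡j s∈))) λ _ → iz

  -- The exchange of indices in reverse. If the witness is the extra vertex of class j, then `S`
  -- lies in `L`, and a vertex of `L` outside `S` takes over unless `S` is `L`.
  near⇒UG : ∀ {S} x → x ∉ S → (∀ {s} → s ∈ S → Near x s) → (q ≤ p ⊎ S ≢ L) → UG S
  near⇒UG {S} x x∉ near ok with c x ≟ᶠ i | c x ≟ᶠ j
  ... | no ≢i | no ≢j = UG-intro x x∉ λ s∈ → same (near s∈)
    where
    same : ∀ {s} → Near x s → c x ≡ c s
    same (inj₁ e) = cong c e
    same (inj₂ (inj₁ (inj₁ (e , _) , _))) = contradiction e ≢i
    same (inj₂ (inj₁ (inj₂ (e , _) , _))) = contradiction e ≢j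
    same (inj₂ (inj₂ (_ , e))) = e
  ... | yes cx≡i | _ =
    let y , cy , iy = vertex a j (ix x)
          (<-≤-trans (subst (λ k → ix x <ⁿ lookup a k) cx≡i (index<size a x)) p≤q)
    in UG-intro y (λ y∈ → proj₂ (facts y∈) (sym iy)) λ s∈ → trans cy (sym (proj₁ (facts s∈)))
    where
    facts : ∀ {s} → s ∈ S → c s ≡ j × ix x ≢ ix s
    facts s∈ with near s∈
    ... | inj₁ refl = contradiction s∈ x∉
    ... | inj₂ (inj₁ (inj₁ (_ , e) , ne)) = e , ne
    ... | inj₂ (inj₁ (inj₂ (e , _) , _)) = contradiction (trans (sym cx≡i) e) i≢j
    ... | inj₂ (inj₂ ((≢i , _) , _)) = contradiction cx≡i ≢i
  ... | no ≢i | yes cx≡j = go (ix x <? p) ok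
    where
    facts : ∀ {s} → s ∈ S → c s ≡ i × ix x ≢ ix s
    facts s∈ with near s∈
    ... | inj₁ refl = contradiction s∈ x∉
    ... | inj₂ (inj₁ (inj₁ (e , _) , _)) = contradiction e ≢i
    ... | inj₂ (inj₁ (inj₂ (_ , e) , ne)) = e , ne
    ... | inj₂ (inj₂ ((_ , ≢j) , _)) = contradiction cx≡j ≢j
    go : Dec (ix x <ⁿ p) → q ≤ p ⊎ S ≢ L → UG S
    go (yes lt) _ =
      let y , cy , iy = vertex a i (ix x) lt
      in UG-intro y (λ y∈ → proj₂ (facts y∈) (sym iy)) λ s∈ → trans cy (sym (proj₁ (facts s∈)))
    go (no ≮) (inj₁ q≤p) = contradiction
      (<-≤-trans (subst (λ k → ix x <ⁿ lookup a k) cx≡j (index<size a x)) q≤p) ≮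
    go (no ≮) (inj₂ S≢L) =
      let z , z∈ , z∉ = missing (λ s∈ → ∈L (proj₁ (facts s∈))) S≢L
      in UG-intro z z∉ λ s∈ → trans (proj₁ (∈-fromPred⁻ left? z∈)) (sym (proj₁ (facts s∈)))

  backward : ∀ {S} → UH S → (q ≤ p ⊎ S ≢ L) → UG S
  backward (x , _ , x∉ , S⊆) = near⇒UG x x∉ (UH-near x S⊆)

  module _ (p<q : p <ⁿ q) where

    r₀ : ∃ λ x → c x ≡ j × ix x ≡ p
    r₀ = vertex a j p p<q

    R′-UG : UG R′
    R′-UG = let x , cx , ix≡ = r₀ in
      UG-intro x (λ x∈ → <⇒≢ (proj₂ (∈-fromPred⁻ right? x∈)) ix≡)
        λ s∈ → trans cx (sym (proj₁ (∈-fromPred⁻ right? s∈)))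

    L-UH : UH L
    L-UH = let x , cx , ix≡ = r₀ in
      UH-intro x (λ x∈ → i≢j (trans (sym (proj₁ (∈-fromPred⁻ left? x∈))) cx))
        λ s∈ → let cs , is = ∈-fromPred⁻ left? s∈ in
          inj₂ (inj₁ (inj₂ (cx , cs) , λ e → <⇒≢ is (trans (sym e) ix≡)))

  L-¬UG : ¬ UG L
  L-¬UG (x , _ , x∉ , L⊆) =
    let s , cs , is = vertex a i 0 (≤-trans (s≤s z≤n) 2≤p)
    in x∉ (∈L (trans (same-colour (L⊆ (∈L cs))) cs))

  -- Being near the vertex of index 0 in class j without lying in `R′` places a witness in class i,
  -- so its index is below p. But it is not near the vertex of `R′` with that same index.
  R′-¬UH : ¬ UH R′
  R′-¬UH (x , _ , x∉ , R′⊆) = second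
    where
    0<p : 0 <ⁿ p
    0<p = ≤-trans (s≤s z≤n) 2≤p
    ∈R′ : ∀ {s} → c s ≡ j → ix s <ⁿ p → s ∈ R′
    ∈R′ cs is = ∈-fromPred⁺ right? (cs , is)
    cx≡i : c x ≡ i
    cx≡i with vertex a j 0 (<-≤-trans 0<p p≤q)
    ... | s , cs , is with UH-near x R′⊆ (∈R′ cs (subst (_<ⁿ p) (sym is) 0<p))
    ... | inj₁ refl = contradiction (∈R′ cs (subst (_<ⁿ p) (sym is) 0<p)) x∉
    ... | inj₂ (inj₁ (inj₁ (e , _) , _)) = e
    ... | inj₂ (inj₁ (inj₂ (_ , e) , _)) = contradiction (trans (sym e) cs) i≢j
    ... | inj₂ (inj₂ ((_ , ≢j) , e)) = contradiction (trans e cs) ≢j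
    ix<p : ix x <ⁿ p
    ix<p = subst (λ k → ix x <ⁿ lookup a k) cx≡i (index<size a x)
    second : ⊥
    second with vertex a j (ix x) (<-≤-trans ix<p p≤q)
    ... | s , cs , is with UH-near x R′⊆ (∈R′ cs (subst (_<ⁿ p) (sym is) ix<p))
    ... | inj₁ refl = i≢j (trans (sym cx≡i) cs)
    ... | inj₂ (inj₁ (_ , ne)) = ne (sym is)
    ... | inj₂ (inj₂ ((≢i , _) , _)) = ≢i cx≡i

  all : List (Subset (v (𝒦 a)))
  all = subsets (v (𝒦 a))

  uG? : ∀ S → Dec (UG S)
  uG? = Tolerance.face? (nonadjacency (𝒦 a)) (0 ≤?_)
  uH? : ∀ S → Dec (UH S)
  uH? = Tolerance.face? (nonadjacency H) (0 ≤?_)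

  single : ∀ {U : Subset (v (𝒦 a)) → Set} (U? : ∀ S → Dec (U S)) k {X} → U X → ∣ X ∣ ≡ p →
    ∑ all (λ S → ⟦ ((∣ S ∣ ≟ k) ×-dec U? S) ×-dec (S ≟ˢ X) ⟧) ≡ ⟦ p ≟ k ⟧
  single U? k {X} uX ∣X∣ = trans (∑-cong all λ S → trans
      (⟦⟧-cong (((∣ S ∣ ≟ k) ×-dec U? S) ×-dec (S ≟ˢ X)) ((p ≟ k) ×-dec (S ≟ˢ X))
        (λ { ((e , _) , refl) → trans (sym ∣X∣) e , refl })
        (λ { (e , refl) → (trans ∣X∣ e , uX) , refl }))
      (⟦⟧-× (p ≟ k) (S ≟ˢ X)))
    (trans (∑-*ˡ all ⟦ p ≟ k ⟧ _) (trans (cong (⟦ p ≟ k ⟧ *_) (∑-δ X)) (*-identityʳ _)))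

  same-#undominated : ∀ k → #undominated H k ≡ #undominated (𝒦 a) k
  same-#undominated k with q ≤? p
  ... | yes q≤p = ∑-cong all λ S →
    ⟦⟧-cong ((∣ S ∣ ≟ k) ×-dec uH? S) ((∣ S ∣ ≟ k) ×-dec uG? S)
      (λ { (e , u) → e , backward u (inj₁ q≤p) }) (λ { (e , u) → e , forward u (inj₁ q≤p) })
  ... | no q≰p = begin
    ∑ all (λ S → ⟦ (∣ S ∣ ≟ k) ×-dec uH? S ⟧)
      -- The exceptional set is split off on each side, `L` here and `R′` below; both have p
      -- elements and contribute equally.
      ≡⟨ trans (∑-cong all λ S → ⟦⟧-split ((∣ S ∣ ≟ k) ×-dec uH? S) (S ≟ˢ L))
           (∑-+ all _ _) ⟩
    ∑ all (λ S → ⟦ ((∣ S ∣ ≟ k) ×-dec uH? S) ×-dec (S ≟ˢ L) ⟧) +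
    ∑ all (λ S → ⟦ ((∣ S ∣ ≟ k) ×-dec uH? S) ×-dec ¬? (S ≟ˢ L) ⟧)
      ≡⟨ cong₂ _+_
           (trans (single uH? k (L-UH (≰⇒> q≰p)) ∣L∣) (sym (single uG? k (R′-UG (≰⇒> q≰p)) ∣R′∣)))
           (∑-cong all λ S → ⟦⟧-cong
             (((∣ S ∣ ≟ k) ×-dec uH? S) ×-dec ¬? (S ≟ˢ L))
             (((∣ S ∣ ≟ k) ×-dec uG? S) ×-dec ¬? (S ≟ˢ R′))
             (λ { ((e , u) , ≢L) → (e , backward u (inj₂ ≢L)) , λ { refl → R′-¬UH u } })
             (λ { ((e , u) , ≢R′) → (e , forward u (inj₂ ≢R′)) , λ { refl → L-¬UG u } })) ⟩
    ∑ all (λ S → ⟦ ((∣ S ∣ ≟ k) ×-dec uG? S) ×-dec (S ≟ˢ R′) ⟧) +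
    ∑ all (λ S → ⟦ ((∣ S ∣ ≟ k) ×-dec uG? S) ×-dec ¬? (S ≟ˢ R′) ⟧)
      ≡⟨ trans (∑-cong all λ S → ⟦⟧-split ((∣ S ∣ ≟ k) ×-dec uG? S) (S ≟ˢ R′))
           (∑-+ all _ _) ⟨
    ∑ all (λ S → ⟦ (∣ S ∣ ≟ k) ×-dec uG? S ⟧) ∎
    where open ≡-Reasoning

  D≈ : D H ≈ₚ D (𝒦 a)
  D≈ zero = refl
  D≈ (suc k) = trans (coeff-D H k) (trans
    (#undominated⇒d H (𝒦 a) refl (suc k) (same-#undominated (suc k))) (sym (coeff-D (𝒦 a) k)))

  -- Non-adjacency is not transitive in H: two vertices of L have a common non-neighbour in class j.
  H≇ : ¬ H ≅ 𝒦 a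
  H≇ (f , rel) =
    -- The index 2 differs from the indices 0 and 1, so `s` is near both `l` and `l′`; it exists
    -- because q ≥ 3.
    let l , cl , il = vertex a i 0 (≤-trans (s≤s z≤n) 2≤p)
        l′ , cl′ , il′ = vertex a i 1 2≤p
        s , cs , is = vertex a j 2 3≤q
    in l≁l′ cl il cl′ il′ (back (trans
         (image (inj₂ (inj₁ (inj₁ (cl , cs) , λ e → contradiction (trans (sym il) (trans e is)) λ ()))))
         (sym (image (inj₂ (inj₁ (inj₁ (cl′ , cs) ,
           λ e → contradiction (trans (sym il′) (trans e is)) λ ())))))))
    where
    g : V → V
    g = Inverse.to f
    image : ∀ {x y} → Near x y → c (g x) ≡ c (g y)
    image {x} {y} near = decidable-stable (c (g x) ≟ᶠ c (g y))
      λ ne → Equivalence.from (rel x y) ne near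
    back : ∀ {x y} → c (g x) ≡ c (g y) → Near x y
    back {x} {y} e = decidable-stable (near? x y) λ ¬near → Equivalence.to (rel x y) ¬near e
    l≁l′ : ∀ {x y} → c x ≡ i → ix x ≡ 0 → c y ≡ i → ix y ≡ 1 → ¬ Near x y
    l≁l′ cx i0 cy i1 (inj₁ refl) = contradiction (trans (sym i0) i1) λ ()
    l≁l′ cx i0 cy i1 (inj₂ (inj₁ (inj₁ (_ , e) , _))) = i≢j (trans (sym cy) e)
    l≁l′ cx i0 cy i1 (inj₂ (inj₁ (inj₂ (e , _) , _))) = i≢j (trans (sym cx) e)
    l≁l′ cx i0 cy i1 (inj₂ (inj₂ ((≢i , _) , _))) = ≢i cx

  not-D-unique : ¬ D-Unique (𝒦 a)
  not-D-unique unique = H≇ (unique H D≈)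

-- Separated class sizes and the characterisation

Separated : ℕ → ℕ → Set
Separated p q = (p ⊔ q ≤ 2) ⊎ (2 ≤ ∣ p - q ∣)

separated? : ∀ p q → Dec (Separated p q)
separated? p q = (p ⊔ q ≤? 2) ⊎-dec (2 ≤? ∣ p - q ∣)

Separated-sym : ∀ p q → Separated p q → Separated q p
Separated-sym p q = Sum.map (subst (_≤ 2) (⊔-comm p q)) (subst (2 ≤_) (∣-∣-comm p q))

¬Separated : ∀ {p q} → p ≤ q → ¬ Separated p q → q ≤ suc p × 3 ≤ q
¬Separated {p} {q} p≤q ¬sep =
  (let q∸p≤1 = ≤-pred (≰⇒> λ le → ¬sep (inj₂ (subst (2 ≤_) (sym (m≤n⇒∣m-n∣≡n∸m p≤q)) le)))
   in ≤-trans (m≤n+m∸n q p) (≤-trans (+-monoʳ-≤ p q∸p≤1) (≤-reflexive (+-comm p 1)))) ,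
  ≰⇒> λ le → ¬sep (inj₁ (subst (_≤ 2) (sym (m≤n⇒m⊔n≡n p≤q)) le))

Separated-adjacent : ∀ {p q} → Separated p q → 3 ≤ p → ¬ (q ≡ p ⊎ suc q ≡ p)
Separated-adjacent {p} {q} (inj₁ le) 3≤p _ = <⇒≱ 3≤p (≤-trans (m≤m⊔n p q) le)
Separated-adjacent {p} (inj₂ le) _ (inj₁ refl) =
  contradiction (≤-trans le (≤-reflexive (∣n-n∣≡0 p))) λ ()
Separated-adjacent {q = q} (inj₂ le) _ (inj₂ refl) =
  contradiction (≤-trans le (≤-reflexive (∣suc-∣≡1 q))) λ { (s≤s ()) }
  where
  ∣suc-∣≡1 : ∀ q → ∣ suc q - q ∣ ≡ 1
  ∣suc-∣≡1 zero = refl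
  ∣suc-∣≡1 (suc q) = ∣suc-∣≡1 q

lookup≤sum : ∀ {r} (a : Vec ℕ r) i → lookup a i ≤ Vec.sum a
lookup≤sum (m ∷ a) zero = m≤m+n m _
lookup≤sum (m ∷ a) (suc i) = ≤-trans (lookup≤sum a i) (m≤n+m _ m)

theorem1p4 : (r : ℕ) → 1 ≤ r → (a : Vec ℕ r) → (∀ i → 1 ≤ lookup a i) →
    D-Unique (𝒦 a) ⇔
    (∀ (i j : Fin r) → i < j →
    (lookup a i ⊔ lookup a j ≤ 2) ⊎ (2 ≤ ∣ lookup a i - lookup a j ∣))
theorem1p4 (suc r) _ a 1≤a = mk⇔ necessary sufficient
  where
  open Multipartite a

  necessary : D-Unique (𝒦 a) → ∀ i j → i < j → Separated (lookup a i) (lookup a j)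
  necessary unique i j i<j = decidable-stable (separated? (lookup a i) (lookup a j)) λ ¬sep →
    -- The rewiring takes the smaller class first, so both orders of the sizes are considered.
    [ (λ le → let q≤1+p , 3≤q = ¬Separated le ¬sep in
                 Twin.not-D-unique a i j (<ᶠ⇒≢ i<j) le q≤1+p 3≤q unique)
             , (λ le → let q≤1+p , 3≤q = ¬Separated le (¬sep ∘ Separated-sym (lookup a j) _) in
                 Twin.not-D-unique a j i (<ᶠ⇒≢ i<j ∘ sym) le q≤1+p 3≤q unique)
             ]′ (≤-total (lookup a i) (lookup a j))

  sufficient : (∀ i j → i < j → Separated (lookup a i) (lookup a j)) → D-Unique (𝒦 a)
  sufficient sep = clean-D-unique (𝒦 a) (≤-trans (1≤a zero) (lookup≤sum a zero)) class-clean
    λ x y 3≤ eq → same-colour⁻ (decidable-stable (c x ≟ᶠ c y) λ ne →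
      Separated-adjacent (pair (c x) (c y) ne) (subst (3 ≤_) (size≡lookup x) 3≤)
        (Sum.map (λ e → trans (sym (size≡lookup y)) (trans e (size≡lookup x)))
                      (λ e → trans (cong suc (sym (size≡lookup y))) (trans e (size≡lookup x))) eq))
    where
    pair : ∀ i j → i ≢ j → Separated (lookup a i) (lookup a j)
    pair i j i≢j with <ᶠ-cmp i j
    ... | tri< i<j _ _ = sep i j i<j
    ... | tri≈ _ e _ = contradiction e i≢j
    ... | tri> _ _ j<i = Separated-sym (lookup a j) _ (sep j i j<i)
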